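{- (Matsumoto's theorem for atomic reduced expressions in type $A$.) Let $W=\mathcal{S}_n$, $S=\{s_1,\dots,s_{n-1}\}$, let $I,J\subset S$ and let $p$ be a core $(I,J)$-coset. Then any two atomic reduced expressions of $p$ are related by a sequence of atomic braid relations $$\mathtt a_i.\mathtt a_{i+1}.\mathtt a_i\ \leftrightarrow\ \mathtt a_{i+1}.\mathtt a_i.\mathtt a_{i+1},\qquad \mathtt a_i.\mathtt a_j\ \leftrightarrow\ \mathtt a_j.\mathtt a_i\ \ (|i-j|>1).$$
   Context: $W=\mathcal S_n$ with simple reflections $s_i=(i\ i{+}1)$ and length $\ell$. For $I\subset S$, $W_I$ is the parabolic subgroup, $w_I$ its longest element, $\ell(I)=\ell(w_I)$. An $(I,J)$-coset is an element $p\in W_I\backslash W/W_J$ (with $(I,J)$ part of the data), with Bruhat-maximal element $\overline p$ and Bruhat-minimal element $\underline p$. It is a core coset if $I=\underline pJ\underline p^{ -1}$. Composition: let $*$ be the $0$-Hecke (star) product on $W$ ($s*w=sw$ if $\ell(sw)>\ell(w)$, else $s*w=w$). For an $(I,J)$-coset $p$ and a $(J,K)$-coset $q$, $p*q=W_I(\overline p*\overline q)W_K$, and $\overline{p*q}=\overline p*\overline q$. It is reduced, written $p.q$, if $\overline p*\overline q=(\overline pw_J^{ -1})\overline q$ with $\ell(\overline p*\overline q)=\ell(\overline p)-\ell(J)+\ell(\overline q)$. A longer composition is reduced if each successive binary composition is. Atomic cosets: for $J\subset S$ write $S\setminus J=\{s_{d_1},\dots,s_{d_l}\}$ with $d_1<\dots<d_l$.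 For $s=s_{d_i}$, put $M=J\cup\{s\}$ and $t=w_Msw_M$; $\mathtt a_i^J$ denotes the $(M\setminus\{t\},J)$-coset containing $w_M$. These are exactly the atomic cosets ending in $J$. An atomic reduced expression for $p$ is a sequence of composable atomic cosets $\mathtt a^{J_d}_{i_d},\dots,\mathtt a^{J_0}_{i_0}$ (with $J_0=J$) whose composition $\mathtt a^{J_d}_{i_d}*\cdots*\mathtt a^{J_0}_{i_0}$ is reduced and equal to $p$ (the empty sequence is allowed for an identity coset). The superscripts are determined by $J_0$ and the indices, so they are omitted. An atomic braid relation replaces a consecutive subsequence of an atomic reduced expression by the other side of one of the displayed relations, with superscripts the unique ones making the composition well defined with the same rightmost subset. -}

module Defs where

open import Data.Fin using (Fin; zero; suc; toℕ; inject₁)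
import Data.Fin.Properties as Fin
open import Data.Fin.Permutation as Perm
  using (Permutation′; _⟨$⟩ʳ_; _∘ₚ_; _≈_; transpose; flip; remove; lift₀; lift₀-remove)
import Data.Fin.Permutation.Components as PC
open import Data.Fin.Subset using (Subset; _∈_; _∪_; ⁅_⁆; _-_)
open import Data.Fin.Subset.Properties using (_∈?_)
open import Data.List using (List; []; _∷_; _++_; map; foldr; filter; length; lookup; allFin)
open import Data.List.Relation.Unary.All using (All)
open import Data.Nat using (ℕ; zero; suc; _+_; _∸_; _≤_; _<_; z≤n; s≤s; _<?_; ∣_-_∣)
open import Data.Nat.Properties using (suc-injective)
open import Data.Product using (∃; ∃-syntax; _×_; _,_; proj₁; proj₂)
open import Relation.Nullary using (Dec; yes; no; contradiction)
open import Relation.Nullary.Decidable using (map′; ¬?; ⌊_⌋; dec-true)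
open import Relation.Binary.PropositionalEquality
  using (_≡_; refl; sym; trans; cong)
open import Relation.Binary.Construct.Closure.Equivalence using (EqClosure)
open import Data.Bool using (if_then_else_)

private
  variable
    m : ℕ

-- Throughout, n = suc m, so that Fin m indexes the m = n - 1 simple reflections.

W : ℕ → Set
W m = Permutation′ (suc m)

-- Product of permutations as functions: (x · y)(k) = x(y(k)).

infixl 7 _·_

_·_ : W m → W m → W m
x · y = y ∘ₚ x

1ᵂ : W m
1ᵂ = Perm.id

infix 8 _⁻¹

_⁻¹ : W m → W m
x ⁻¹ = flip x

s : Fin m → W m
s i = transpose (inject₁ i) (suc i)

⟦_⟧ : List (Fin m) → W m
⟦ u ⟧ = foldr (λ i x → s i · x) 1ᵂ u

HasWord : W m → ℕ → Set
HasWord {m} x k = ∃[ u ] (length u ≡ k × ⟦_⟧ {m} u ≈ x)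

private

  s-involutive : (i : Fin m) (x : W m) → s i · (s i · x) ≈ x
  s-involutive i x k = swap-swap (inject₁ i) (suc i) (x ⟨$⟩ʳ k)
    where
    swap-comm : ∀ {n} (a b c : Fin n) → PC.transpose a b c ≡ PC.transpose b a c
    swap-comm a b c with c Fin.≟ a in eqa | c Fin.≟ b in eqb
    ... | yes p | yes q = trans (sym q) p
    ... | yes _ | no _ rewrite eqa = refl
    ... | no _ | yes _ rewrite eqb = refl
    ... | no _ | no _ rewrite eqa | eqb = refl

    swap-swap : ∀ {n} (a b c : Fin n) → PC.transpose a b (PC.transpose a b c) ≡ c
    swap-swap a b c =
      trans (cong (PC.transpose a b) (swap-comm a b c)) (PC.transpose-inverse a b)

  HasWord-cons : (i : Fin m) {x : W m} {k : ℕ} → HasWord (s i · x) k → HasWord x (suc k)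
  HasWord-cons i {x} (u , len , eq) =
    i ∷ u , cong suc len ,
    λ k → trans (cong (s i ⟨$⟩ʳ_) (eq k)) (s-involutive i x k)

  hasWord? : (x : W m) (k : ℕ) → Dec (HasWord x k)
  hasWord? x zero =
    map′ (λ eq → [] , refl , eq) (λ { ([] , _ , eq) → eq })
         (Fin.all? (λ k → k Fin.≟ (x ⟨$⟩ʳ k)))
  hasWord? x (suc k) =
    map′ (λ { (i , h) → HasWord-cons i {x} h })
         (λ { (i ∷ u , len , eq) →
              i , u , suc-injective len ,
              λ j → trans (sym (s-involutive i ⟦ u ⟧ j)) (cong (s i ⟨$⟩ʳ_) (eq j)) })
         (Fin.any? (λ i → hasWord? (s i · x) k))

  lift-word : (u : List (Fin m)) → ⟦ map suc u ⟧ ≈ lift₀ ⟦ u ⟧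
  lift-word [] k = sym (Perm.lift₀-id k)
  lift-word (i ∷ u) k =
    trans (cong (s (suc i) ⟨$⟩ʳ_) (lift-word u k))
    (trans (Perm.lift₀-transpose (inject₁ i) (suc i) (lift₀ ⟦ u ⟧ ⟨$⟩ʳ k))
           (Perm.lift₀-comp ⟦ u ⟧ (s i) k))

  s-lowers : (i : Fin m) → s i ⟨$⟩ʳ suc i ≡ inject₁ i
  s-lowers i with suc i Fin.≟ inject₁ i
  ... | yes eq = eq
  ... | no _ rewrite dec-true (i Fin.≟ i) refl = refl

  word : (x : W m) → ∃ (HasWord x)
  word {zero} x = 0 , [] , refl , λ { zero → fixed (x ⟨$⟩ʳ zero) }
    where
    fixed : (k : Fin 1) → zero ≡ k
    fixed zero = refl
  word {suc m} x = descend (toℕ (x ⟨$⟩ʳ zero)) x refl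
    where
    descend : (k : ℕ) (y : W (suc m)) → toℕ (y ⟨$⟩ʳ zero) ≡ k → ∃ (HasWord y)
    descend zero y y0≡0 with word (remove zero y)
    ... | _ , u , _ , eq =
      _ , map suc u , refl ,
      λ k → trans (lift-word u k)
            (trans (Perm.lift₀-cong ⟦ u ⟧ (remove zero y) eq k)
                   (lift₀-remove y (Fin.toℕ-injective y0≡0) k))
    descend (suc k) y y0≡k with y ⟨$⟩ʳ zero in eq
    ... | suc i with descend k (s i · y)
                       (trans (cong toℕ (trans (cong (s i ⟨$⟩ʳ_) eq) (s-lowers i)))
                              (trans (Fin.toℕ-inject₁ i) (suc-injective y0≡k)))
    ...   | l , h = suc l , HasWord-cons i {y} h

  least : {P : ℕ → Set} → (∀ k → Dec (P k)) → ∀ k → P k →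
          ∃[ l ] (P l × (∀ j → P j → l ≤ j))
  least P? zero p = zero , p , λ _ _ → z≤n
  least P? (suc k) p with P? zero
  ... | yes p₀ = zero , p₀ , λ _ _ → z≤n
  ... | no ¬p₀ with least (λ j → P? (suc j)) k p
  ...   | l , pl , min = suc l , pl ,
            λ { zero p₀ → contradiction p₀ ¬p₀ ; (suc j) pj → s≤s (min j pj) }

  shortest : (x : W m) → ∃[ l ] (HasWord x l × (∀ k → HasWord x k → l ≤ k))
  shortest x = least (hasWord? x) (proj₁ (word x)) (proj₂ (word x))

ℓ : W m → ℕ
ℓ x = proj₁ (shortest x)

ℓ-word : (x : W m) → HasWord x (ℓ x)
ℓ-word x = proj₁ (proj₂ (shortest x))

ℓ-minimal : (x : W m) (k : ℕ) → HasWord x k → ℓ x ≤ k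
ℓ-minimal x = proj₂ (proj₂ (shortest x))

IsReducedWord : List (Fin m) → W m → Set
IsReducedWord u x = ⟦ u ⟧ ≈ x × length u ≡ ℓ x

infix 4 _≤ᴮ_

data _≤ᴮ_ {m : ℕ} : W m → W m → Set where
  ≤ᴮ-refl : ∀ {x y} → x ≈ y → x ≤ᴮ y
  ≤ᴮ-step : ∀ {x y z} (i j : Fin (suc m)) →
            y ≈ x · transpose i j → ℓ x < ℓ y → y ≤ᴮ z → x ≤ᴮ z

_⋆ˢ_ : Fin m → W m → W m
i ⋆ˢ y = if ⌊ ℓ y <? ℓ (s i · y) ⌋ then s i · y else y

-- x ⋆ y ≔ z says that z is the 0-Hecke product of x and y.  For a reduced
-- word x = s₁ ⋯ sₖ that product is s₁ * (⋯ * (sₖ * y)), whichever reduced word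
-- of x is used.

infix 4 _⋆_≔_

_⋆_≔_ : W m → W m → W m → Set
x ⋆ y ≔ z = ∃[ u ] (IsReducedWord u x × foldr _⋆ˢ_ y u ≈ z)

infix 4 _∈⟨_⟩

_∈⟨_⟩ : W m → Subset m → Set
x ∈⟨ I ⟩ = ∃[ u ] (All (_∈ I) u × ⟦ u ⟧ ≈ x)

IsLongest : Subset m → W m → Set
IsLongest I w = w ∈⟨ I ⟩ × (∀ x → x ∈⟨ I ⟩ → ℓ x ≤ ℓ w)

-- The double coset W_I rep W_J, remembering I and J.  Different representatives
-- may give the same coset, so cosets are only ever compared through _∈ᶜ_.

record Coset (I J : Subset m) : Set where
  constructor coset
  field
    rep : W m

open Coset public

private
  variable
    I J K : Subset m

infix 4 _∈ᶜ_

_∈ᶜ_ : W m → Coset {m} I J → Set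
_∈ᶜ_ {I = I} {J = J} x p =
  ∃[ u ] ∃[ v ] (u ∈⟨ I ⟩ × v ∈⟨ J ⟩ × x ≈ u · rep p · v)

IsMax : Coset {m} I J → W m → Set
IsMax p x = x ∈ᶜ p × (∀ y → y ∈ᶜ p → y ≤ᴮ x)

IsMin : Coset {m} I J → W m → Set
IsMin p x = x ∈ᶜ p × (∀ y → y ∈ᶜ p → x ≤ᴮ y)

-- I = x J x⁻¹ as sets of simple reflections.

IsConjugate : W m → Subset m → Subset m → Set
IsConjugate x I J =
    (∀ i → i ∈ I → ∃[ j ] (j ∈ J × s i ≈ x · s j · x ⁻¹))
  × (∀ j → j ∈ J → ∃[ i ] (i ∈ I × s i ≈ x · s j · x ⁻¹))

IsCore : Coset {m} I J → Set
IsCore {I = I} {J = J} p = ∃[ x ] (IsMin p x × IsConjugate x I J)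

-- The composition of p and q is reduced and equals r, i.e. r = p . q.  The
-- composition is the coset containing z, the 0-Hecke product of the maximal
-- elements x of p and y of q; it is determined by any one of its elements.

record _⊙_≔_ {I J K : Subset m}
             (p : Coset I J) (q : Coset J K) (r : Coset I K) : Set where
  field
    x y z w   : W m
    x-max     : IsMax p x
    y-max     : IsMax q y
    product   : x ⋆ y ≔ z
    z∈r       : z ∈ᶜ r
    w-longest : IsLongest J w
    z-eq      : z ≈ x · w ⁻¹ · y
    length-eq : ℓ z ≡ (ℓ x ∸ ℓ w) + ℓ y

infix 4 _⊙_≔_

-- The indices of S ∖ J, in increasing order.

gaps : Subset m → List (Fin m)
gaps {m} J = filter (λ i → ¬? (i ∈? J)) (allFin m)

-- a is the atomic coset aᵢᴶ; i counts the elements of S ∖ J from 1.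

record IsAtomic (i : ℕ) {L J : Subset m} (a : Coset L J) : Set where
  field
    k         : Fin (length (gaps J))
    i-eq      : i ≡ suc (toℕ k)

  d : Fin m
  d = lookup (gaps J) k

  M : Subset m
  M = J ∪ ⁅ d ⁆

  field
    w         : W m
    w-longest : IsLongest M w
    t         : Fin m
    t-eq      : s t ≈ w · s d · w
    left-eq   : L ≡ M - t
    w∈a       : w ∈ᶜ a

-- The index sequence i_d , … , i_0 (leftmost factor first) is an atomic reduced
-- expression of p.  The atomic factors, and hence all the intermediate
-- subsets, are determined by the indices and the right-hand subset of p.

data IsReducedExpression {m : ℕ} :
  List ℕ → {I J : Subset m} → Coset I J → Set where
  []  : ∀ {I J} {p : Coset I J} → I ≡ J → 1ᵂ ∈ᶜ p → IsReducedExpression [] p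
  _∷_ : ∀ {i is L I J} {a : Coset L I} {q : Coset I J} {p : Coset L J} →
        IsAtomic i a × a ⊙ q ≔ p → IsReducedExpression is q →
        IsReducedExpression (i ∷ is) p

data Braid : List ℕ → List ℕ → Set where
  braid : ∀ us vs i →
          Braid (us ++ i ∷ suc i ∷ i ∷ vs) (us ++ suc i ∷ i ∷ suc i ∷ vs)
  comm  : ∀ us vs i j → 1 < ∣ i - j ∣ →
          Braid (us ++ i ∷ j ∷ vs) (us ++ j ∷ i ∷ vs)

AtomicBraid : Coset {m} I J → List ℕ → List ℕ → Set
AtomicBraid p us vs = IsReducedExpression us p × IsReducedExpression vs p × Braid us vs

BraidEquivalent : Coset {m} I J → List ℕ → List ℕ → Set
BraidEquivalent p = EqClosure (AtomicBraid p)

{-# OPTIONS --safe #-}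
-- A subset J of S cuts the positions into consecutive blocks.  The elements of a
-- coset p with an atomic expression are exactly the x that permute blocks in a
-- prescribed way g, and the Bruhat-maximal one is the x that is decreasing on every
-- block.  The atomic coset aᵢ swaps the i-th and (i+1)-st blocks, and composing it
-- with q is reduced exactly if these two blocks were in increasing order before the
-- swap.  So the atomic reduced expressions of p are the reduced words of g, and
-- conversely every reduced word of g is realised by atomic cosets with composition
-- p.  This leaves Matsumoto's theorem for adjacent transpositions of ℕ, which
-- follows from the exchange property.
module Submission where

open import Defs
open import Data.Nat
  using (ℕ; zero; suc; _+_; _∸_; _⊔_; _≤_; _<_; z≤n; s≤s; ∣_-_∣; _≟_; _<?_; _≤?_)
open import Data.Nat.Properties hiding (_≟_; _<?_; _≤?_)
open import Data.Bool using (if_then_else_)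
open import Data.Fin as Fin using (Fin; zero; suc; toℕ; inject₁; fromℕ; opposite)
import Data.Fin.Properties as Finₚ
open import Data.Fin.Induction using (<-weakInduction; >-weakInduction)
import Data.Fin.Permutation as Perm
open import Data.Fin.Permutation using (_⟨$⟩ʳ_; _⟨$⟩ˡ_; _≈_; inverseˡ; inverseʳ)
open import Data.Fin.Subset using (Subset; inside; outside; _∈_; _∉_; _∪_; ⁅_⁆; _-_; ⊥)
open import Data.Fin.Subset.Properties using (_∈?_; x∈⁅x⁆; x∈p∪q⁺; ∪-identityʳ; p─⊥≡p)
open import Data.List using (List; []; _∷_; _++_; length; map; filter; foldr; allFin; lookup; tabulate)
open import Data.List.Properties using (length-++; length-map; map-tabulate; foldr-++)
open import Data.List.Relation.Unary.All using (All; []; _∷_)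
import Data.List.Relation.Unary.All.Properties as All
open import Data.Product using (∃; ∃-syntax; _×_; _,_; proj₁; proj₂)
open import Data.Sum using (_⊎_; inj₁; inj₂)
open import Data.Vec using ([]; _∷_; here; there)
open import Function using (_∘_; id)
open import Relation.Nullary using (¬_; Dec; yes; no; does; contradiction)
open import Relation.Nullary.Decidable using (dec-true; dec-false; ¬?; _×-dec_; ⌊_⌋)
open import Relation.Binary using (tri<; tri≈; tri>)
open import Relation.Binary.PropositionalEquality hiding (J)
open import Relation.Binary.Construct.Closure.Equivalence as EqC using (EqClosure)
open import Relation.Binary.Construct.Closure.ReflexiveTransitive using (ε; _◅◅_)

-- All subsets occurring in one expression cut out the same number of blocks, but this is a theorem
-- and not a definitional fact. Letting `g` act on all of ℕ, with a bound `l` on the letters, avoids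
-- transporting along it; `g` fixes everything above `l`, so nothing is left undetermined there. `g`
-- goes from the blocks of the left-hand subset to those of the right-hand one. It is therefore the
-- inverse of the product of its letters, and a new leftmost factor turns `g` into `g ∘ τ k`.
--
-- The delicate point of the converse is that a braid step counts only if both sides are expressions
-- of the same `p`, left-hand subset included. Rebuilding from a word and `J` produces some subset
-- of its own; it agrees with the given one because an element permuting blocks by `g` and
-- decreasing on the blocks of `J` is unique even when the left-hand subset is left open.
--
-- Lengths are defined by shortest words. Reducedness of a composition is translated into a
-- statement about inversions by a criterion for `ℓ (x · y) ≡ ℓ x + ℓ y`, with no inversions ever
-- counted.

private
  variable
    m l : ℕ
    I J L : Subset m
    g g′ : ℕ → ℕ
    us vs : List ℕ

-- Matsumoto's theorem for adjacent transpositions of ℕ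

τ : ℕ → ℕ → ℕ
τ zero zero = 1
τ zero (suc zero) = 0
τ zero (suc (suc n)) = suc (suc n)
τ (suc k) zero = zero
τ (suc k) (suc n) = suc (τ k n)

τ-involutive : ∀ k n → τ k (τ k n) ≡ n
τ-involutive zero zero = refl
τ-involutive zero (suc zero) = refl
τ-involutive zero (suc (suc n)) = refl
τ-involutive (suc k) zero = refl
τ-involutive (suc k) (suc n) = cong suc (τ-involutive k n)

τ-braid : ∀ k n → τ k (τ (suc k) (τ k n)) ≡ τ (suc k) (τ k (τ (suc k) n))
τ-braid zero zero = refl
τ-braid zero (suc zero) = refl
τ-braid zero (suc (suc zero)) = refl
τ-braid zero (suc (suc (suc n))) = refl
τ-braid (suc k) zero = refl
τ-braid (suc k) (suc n) = cong suc (τ-braid k n)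

τ-comm : ∀ i j → 1 < ∣ i - j ∣ → ∀ n → τ i (τ j n) ≡ τ j (τ i n)
τ-comm zero (suc (suc j)) _ zero = refl
τ-comm zero (suc (suc j)) _ (suc zero) = refl
τ-comm zero (suc (suc j)) _ (suc (suc n)) = refl
τ-comm zero (suc zero) (s≤s ()) n
τ-comm (suc (suc i)) zero _ zero = refl
τ-comm (suc (suc i)) zero _ (suc zero) = refl
τ-comm (suc (suc i)) zero _ (suc (suc n)) = refl
τ-comm (suc zero) zero (s≤s ()) n
τ-comm (suc i) (suc j) p zero = refl
τ-comm (suc i) (suc j) p (suc n) = cong suc (τ-comm i j p n)

τ-left : ∀ k → τ k k ≡ suc k
τ-left zero = refl
τ-left (suc k) = cong suc (τ-left k)

τ-right : ∀ k → τ k (suc k) ≡ k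
τ-right zero = refl
τ-right (suc k) = cong suc (τ-right k)

τ-above : ∀ k {n} → suc k < n → τ k n ≡ n
τ-above zero {suc (suc n)} _ = refl
τ-above zero {suc zero} (s≤s ())
τ-above (suc k) {suc n} (s≤s p) = cong suc (τ-above k p)

τ-below : ∀ k {n} → n < k → τ k n ≡ n
τ-below (suc k) {zero} _ = refl
τ-below (suc k) {suc n} (s≤s p) = cong suc (τ-below k p)

τ-far : ∀ i j → 1 < ∣ i - j ∣ → τ i j ≡ j × τ i (suc j) ≡ suc j
τ-far zero (suc (suc j)) _ = refl , refl
τ-far zero (suc zero) (s≤s ())
τ-far (suc (suc i)) zero _ = refl , refl
τ-far (suc zero) zero (s≤s ())
τ-far (suc i) (suc j) p with τ-far i j p
... | e , f = cong suc e , cong suc f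

τ-mono : ∀ k {m n} → m < n → ¬ (m ≡ k × n ≡ suc k) → τ k m < τ k n
τ-mono zero {zero} {suc zero} p e = contradiction (refl , refl) e
τ-mono zero {zero} {suc (suc n)} p e = s≤s (s≤s z≤n)
τ-mono zero {suc zero} {suc zero} (s≤s ()) e
τ-mono zero {suc zero} {suc (suc n)} p e = s≤s z≤n
τ-mono zero {suc (suc m)} {suc zero} (s≤s ()) e
τ-mono zero {suc (suc m)} {suc (suc n)} p e = p
τ-mono (suc k) {zero} {suc n} p e = s≤s z≤n
τ-mono (suc k) {suc m} {suc n} (s≤s p) e =
  s≤s (τ-mono k p λ (a , b) → e (cong suc a , cong suc b))

-- Letters count from 1, like the indices of atomic cosets: suc k stands for τ k.
data Reduced (l : ℕ) (g : ℕ → ℕ) : List ℕ → Set where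
  nil  : g ≗ id → Reduced l g []
  cons : ∀ {k us} → k < l → g (suc k) < g k → Reduced l (g ∘ τ k) us →
         Reduced l g (suc k ∷ us)

Reduced-resp : g ≗ g′ → Reduced l g us → Reduced l g′ us
Reduced-resp e (nil f) = nil λ n → trans (sym (e n)) (f n)
Reduced-resp e (cons {k} b d r) =
  cons b (subst₂ _<_ (e (suc k)) (e k) d) (Reduced-resp (e ∘ τ k) r)

Reduced-injective : Reduced l g us → ∀ {m n} → g m ≡ g n → m ≡ n
Reduced-injective (nil f) {m} {n} e = trans (sym (f m)) (trans e (f n))
Reduced-injective {g = g} (cons {k} _ _ r) {m} {n} e =
  trans (sym (τ-involutive k m)) (trans (cong (τ k) τm≡τn) (τ-involutive k n))
  where
  τm≡τn : τ k m ≡ τ k n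
  τm≡τn = Reduced-injective r (trans (cong g (τ-involutive k m))
                              (trans e (cong g (sym (τ-involutive k n)))))

Reduced-fixes-above : Reduced l g us → ∀ {n} → l < n → g n ≡ n
Reduced-fixes-above (nil f) {n} _ = f n
Reduced-fixes-above {g = g} (cons {k} k<l _ r) {n} l<n =
  trans (cong g (sym (τ-above k (≤-<-trans k<l l<n)))) (Reduced-fixes-above r l<n)

-- `i` is a parameter and cannot be refined to a successor, so `prev` carries an equation where
-- `next` uses the index.
data Position (i : ℕ) : ℕ → Set where
  same : Position i i
  next : Position i (suc i)
  prev : ∀ {j} → i ≡ suc j → Position i j
  far  : ∀ {j} → 1 < ∣ i - j ∣ → Position i j

position : ∀ i j → Position i j
position zero zero = same
position zero (suc zero) = next
position zero (suc (suc j)) = far (s≤s (s≤s z≤n))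
position (suc zero) zero = prev refl
position (suc (suc i)) zero = far (s≤s (s≤s z≤n))
position (suc i) (suc j) with position i j
... | same = same
... | next = next
... | prev e = prev (cong suc e)
... | far p = far p

far-sym : ∀ i j → 1 < ∣ i - j ∣ → 1 < ∣ j - i ∣
far-sym i j = subst (1 <_) (∣-∣-comm i j)

τ-next : ∀ k → τ (suc k) k ≡ k
τ-next k = τ-below (suc k) (n<1+n k)

τ-skip : ∀ k → τ k (suc (suc k)) ≡ suc (suc k)
τ-skip k = τ-above k (n<1+n (suc k))

-- Here `g` reverses three consecutive numbers, so the longest element of the symmetric group on
-- them can be stripped off in both orders. The four descents are those met after the first letter
-- along the words `k, k+1, k` and `k+1, k, k+1`; by `braided` both end at the same function.
module DoubleDescent (g : ℕ → ℕ) (k : ℕ)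
                     (d : g (suc k) < g k) (d′ : g (suc (suc k)) < g (suc k)) where

  private
    at : ∀ {m m′ n n′} → m′ ≡ m → n′ ≡ n → g m < g n → g m′ < g n′
    at refl refl p = p

  τₖ-desc : (g ∘ τ k) (suc (suc k)) < (g ∘ τ k) (suc k)
  τₖ-desc = at (τ-skip k) (τ-right k) (<-trans d′ d)

  τₖτₖ₊₁-desc : (g ∘ τ k ∘ τ (suc k)) (suc k) < (g ∘ τ k ∘ τ (suc k)) k
  τₖτₖ₊₁-desc = at (trans (cong (τ k) (τ-left (suc k))) (τ-skip k))
                   (trans (cong (τ k) (τ-next k)) (τ-left k)) d′

  τₖ₊₁-desc : (g ∘ τ (suc k)) (suc k) < (g ∘ τ (suc k)) k
  τₖ₊₁-desc = at (τ-left (suc k)) (τ-next k) (<-trans d′ d)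

  τₖ₊₁τₖ-desc : (g ∘ τ (suc k) ∘ τ k) (suc (suc k)) < (g ∘ τ (suc k) ∘ τ k) (suc k)
  τₖ₊₁τₖ-desc = at (trans (cong (τ (suc k)) (τ-skip k)) (τ-right (suc k)))
                   (trans (cong (τ (suc k)) (τ-right k)) (τ-next k)) d

  braided : g ∘ τ k ∘ τ (suc k) ∘ τ k ≗ g ∘ τ (suc k) ∘ τ k ∘ τ (suc k)
  braided = cong g ∘ τ-braid k

far-desc : ∀ (g : ℕ → ℕ) i k → 1 < ∣ i - k ∣ → g (suc k) < g k →
           (g ∘ τ i) (suc k) < (g ∘ τ i) k
far-desc g i k p = subst₂ _<_ (cong g (sym (proj₂ e))) (cong g (sym (proj₁ e)))
  where e = τ-far i k p

-- Compare `k` with the first letter: equal letters cancel, distant ones commute past each other,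
-- and neighbouring ones need the induction hypothesis twice. Its second use is on a word produced
-- by the first and not on a subword, hence the induction on a length bound.
exchange-bounded : ∀ n {k} → length us ≤ n → Reduced l g us → k < l → g (suc k) < g k →
                   ∃[ vs ] (Reduced l (g ∘ τ k) vs × length us ≡ suc (length vs))
exchange-bounded n {k} _ (nil f) _ d =
  contradiction (subst₂ _<_ (f (suc k)) (f k) d) (≤⇒≯ (n≤1+n k))
exchange-bounded {g = g} (suc n) {k} (s≤s b) (cons {i} {us} i<l d₀ r) k<l d with position i k
... | same = us , r , refl
... | far p with exchange-bounded n b r k<l (far-desc g i k p d)
...   | ws , r′ , len =
  suc i ∷ ws
  , cons i<l (far-desc g k i (far-sym i k p) d₀)
      (Reduced-resp (cong g ∘ τ-comm i k p) r′)
  , cong suc len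
exchange-bounded {g = g} (suc n) {k} (s≤s b) (cons {i} i<l d₀ r) k<l d
    | next with exchange-bounded n b r k<l (DoubleDescent.τₖ-desc g i d₀ d)
-- Stripping `k` and then `i` from the tail reaches `g` times the full braid word, from which the
-- other side of the braid leads back to `g ∘ τ k` in two letters.
... | us₁ , r₁ , len₁
    with exchange-bounded n (<⇒≤ (subst (_≤ n) len₁ b)) r₁ i<l
           (DoubleDescent.τₖτₖ₊₁-desc g i d₀ d)
... | us₂ , r₂ , len₂ =
  suc i ∷ suc k ∷ us₂
  , cons i<l τₖ₊₁-desc (cons k<l τₖ₊₁τₖ-desc (Reduced-resp braided r₂))
  , cong suc (trans len₁ (cong suc len₂))
  where open DoubleDescent g i d₀ d
exchange-bounded {g = g} (suc n) {k} (s≤s b) (cons {i} i<l d₀ r) k<l d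
    | prev refl with exchange-bounded n b r k<l (DoubleDescent.τₖ₊₁-desc g k d d₀)
... | us₁ , r₁ , len₁
    with exchange-bounded n (<⇒≤ (subst (_≤ n) len₁ b)) r₁ i<l
           (DoubleDescent.τₖ₊₁τₖ-desc g k d d₀)
... | us₂ , r₂ , len₂ =
  suc i ∷ suc k ∷ us₂
  , cons i<l τₖ-desc (cons k<l τₖτₖ₊₁-desc (Reduced-resp (sym ∘ braided) r₂))
  , cong suc (trans len₁ (cong suc len₂))
  where open DoubleDescent g k d d₀

exchange : ∀ {k} → Reduced l g us → k < l → g (suc k) < g k →
           ∃[ vs ] (Reduced l (g ∘ τ k) vs × length us ≡ suc (length vs))
exchange {us = us} = exchange-bounded (length us) ≤-refl

BraidStep : ℕ → (ℕ → ℕ) → List ℕ → List ℕ → Set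
BraidStep l g us vs = Reduced l g us × Reduced l g vs × Braid us vs

infix 4 _∣_⊢_~_

_∣_⊢_~_ : ℕ → (ℕ → ℕ) → List ℕ → List ℕ → Set
l ∣ g ⊢ us ~ vs = EqClosure (BraidStep l g) us vs

Braid-cons : ∀ a {us vs} → Braid us vs → Braid (a ∷ us) (a ∷ vs)
Braid-cons a (braid us vs i) = braid (a ∷ us) vs i
Braid-cons a (comm us vs i j p) = comm (a ∷ us) vs i j p

~-cons : ∀ {k} → k < l → g (suc k) < g k → l ∣ g ∘ τ k ⊢ us ~ vs →
         l ∣ g ⊢ suc k ∷ us ~ suc k ∷ vs
~-cons {k = k} k<l d = EqC.gmap (suc k ∷_)
  λ (r , r′ , b) → cons k<l d r , cons k<l d r′ , Braid-cons (suc k) b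

~-sym : l ∣ g ⊢ us ~ vs → l ∣ g ⊢ vs ~ us
~-sym {l} {g} = EqC.symmetric (BraidStep l g)

~-step : BraidStep l g us vs → l ∣ g ⊢ us ~ vs
~-step = EqC.return

-- Both first letters are descents of `g`, so the exchange property yields a pair of reduced words,
-- one starting with each side of the relevant relation and with a common tail `ws`. One step joins
-- these two; the remaining links share a first letter and follow by induction. The length recorded
-- in `exchange` keeps the auxiliary words within the bound.
matsumoto-bounded : ∀ n → length us < n → length vs < n →
                    Reduced l g us → Reduced l g vs → l ∣ g ⊢ us ~ vs
matsumoto-bounded (suc n) _ _ (nil _) (nil _) = ε
matsumoto-bounded (suc n) _ _ (nil f) (cons {k} _ d _) =
  contradiction (subst₂ _<_ (f (suc k)) (f k) d) (≤⇒≯ (n≤1+n k))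
matsumoto-bounded (suc n) _ _ (cons {k} _ d _) (nil f) =
  contradiction (subst₂ _<_ (f (suc k)) (f k) d) (≤⇒≯ (n≤1+n k))
matsumoto-bounded {l = l} {g = g} (suc n) (s≤s lu) (s≤s lv)
  (cons {i} {us} i<l d r) (cons {j} {vs} j<l d′ r′) with position i j
... | same = ~-cons i<l d (matsumoto-bounded n lu lv r r′)
... | far p with exchange r j<l (far-desc g i j p d′)
...   | ws , rs , len =
  ~-cons i<l d (matsumoto-bounded n lu (subst (_< n) len lu) r r₁)
  ◅◅ ~-step (cons i<l d r₁ , cons j<l d′ r₂ , comm [] ws (suc i) (suc j) p)
  ◅◅ ~-cons j<l d′ (matsumoto-bounded n (subst (_< n) len lu) lv r₂ r′)
  where
  r₁ : Reduced l (g ∘ τ i) (suc j ∷ ws)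
  r₁ = cons j<l (far-desc g i j p d′) rs
  r₂ : Reduced l (g ∘ τ j) (suc i ∷ ws)
  r₂ = cons i<l (far-desc g j i (far-sym i j p) d) (Reduced-resp (cong g ∘ τ-comm i j p) rs)
matsumoto-bounded {l = l} {g = g} (suc n) (s≤s lu) (s≤s lv)
  (cons {i} {us} i<l d r) (cons {j} {vs} j<l d′ r′)
    | next with exchange r j<l (DoubleDescent.τₖ-desc g i d d′)
... | us₁ , r₁ , len₁ with exchange r₁ i<l (DoubleDescent.τₖτₖ₊₁-desc g i d d′)
... | ws , rs , len₂ =
  ~-cons i<l d (matsumoto-bounded n lu lw r s₁)
  ◅◅ ~-step (cons i<l d s₁ , cons j<l d′ s₂ , braid [] ws (suc i))
  ◅◅ ~-cons j<l d′ (matsumoto-bounded n lw lv s₂ r′)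
  where
  open DoubleDescent g i d d′
  lw : suc (suc (length ws)) < n
  lw = subst (_< n) (trans len₁ (cong suc len₂)) lu
  s₁ : Reduced l (g ∘ τ i) (suc j ∷ suc i ∷ ws)
  s₁ = cons j<l τₖ-desc (cons i<l τₖτₖ₊₁-desc rs)
  s₂ : Reduced l (g ∘ τ j) (suc i ∷ suc j ∷ ws)
  s₂ = cons i<l τₖ₊₁-desc (cons j<l τₖ₊₁τₖ-desc (Reduced-resp braided rs))
matsumoto-bounded {l = l} {g = g} (suc n) (s≤s lu) (s≤s lv)
  (cons {i} {us} i<l d r) (cons {j} {vs} j<l d′ r′)
    | prev refl with exchange r j<l (DoubleDescent.τₖ₊₁-desc g j d′ d)
... | us₁ , r₁ , len₁ with exchange r₁ i<l (DoubleDescent.τₖ₊₁τₖ-desc g j d′ d)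
... | ws , rs , len₂ =
  ~-cons i<l d (matsumoto-bounded n lu lw r s₁)
  -- `Braid` is oriented with the smaller letter on the outside first, so here the step is run
  -- backwards.
  ◅◅ ~-sym (~-step (cons j<l d′ s₂ , cons i<l d s₁ , braid [] ws (suc j)))
  ◅◅ ~-cons j<l d′ (matsumoto-bounded n lw lv s₂ r′)
  where
  open DoubleDescent g j d′ d
  lw : suc (suc (length ws)) < n
  lw = subst (_< n) (trans len₁ (cong suc len₂)) lu
  s₁ : Reduced l (g ∘ τ i) (suc j ∷ suc i ∷ ws)
  s₁ = cons j<l τₖ₊₁-desc (cons i<l τₖ₊₁τₖ-desc rs)
  s₂ : Reduced l (g ∘ τ j) (suc i ∷ suc j ∷ ws)
  s₂ = cons i<l τₖ-desc (cons j<l τₖτₖ₊₁-desc (Reduced-resp (sym ∘ braided) rs))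

matsumoto : Reduced l g us → Reduced l g vs → l ∣ g ⊢ us ~ vs
matsumoto {us = us} {vs = vs} = matsumoto-bounded (suc (length us ⊔ length vs))
  (s≤s (m≤m⊔n (length us) (length vs))) (s≤s (m≤n⊔m (length us) (length vs)))

-- Lengths and inversions

infix 4 _≺_

_≺_ : Fin m → Fin m → Set
_≺_ = Fin._<_

inject₁≺suc : (k : Fin m) → inject₁ k ≺ suc k
inject₁≺suc k = s≤s (≤-reflexive (Finₚ.toℕ-inject₁ k))

≺suc : {a : Fin (suc m)} (k : Fin m) → a ≺ suc k → a ≡ inject₁ k ⊎ a ≺ inject₁ k
≺suc {a = a} k (s≤s p) with m≤n⇒m<n∨m≡n p
... | inj₁ q = inj₂ (subst (toℕ a <_) (sym (Finₚ.toℕ-inject₁ k)) q)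
... | inj₂ e = inj₁ (Finₚ.toℕ-injective (trans e (sym (Finₚ.toℕ-inject₁ k))))

s-left : (i : Fin m) → s i ⟨$⟩ʳ inject₁ i ≡ suc i
s-left i rewrite dec-true (inject₁ i Fin.≟ inject₁ i) refl = refl

s-right : (i : Fin m) → s i ⟨$⟩ʳ suc i ≡ inject₁ i
s-right i with suc i Fin.≟ inject₁ i
... | yes e = e
... | no _ rewrite dec-true (i Fin.≟ i) refl = refl

s-fix : (i : Fin m) {a : Fin (suc m)} → a ≢ inject₁ i → a ≢ suc i → s i ⟨$⟩ʳ a ≡ a
s-fix i {a} p q rewrite dec-false (a Fin.≟ inject₁ i) p | dec-false (a Fin.≟ suc i) q = refl

data Place (i : Fin m) : Fin (suc m) → Set where
  left  : Place i (inject₁ i)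
  right : Place i (suc i)
  off   : ∀ {a} → a ≢ inject₁ i → a ≢ suc i → Place i a

place : (i : Fin m) (a : Fin (suc m)) → Place i a
place i a with a Fin.≟ inject₁ i | a Fin.≟ suc i
... | yes refl | _ = left
... | no _ | yes refl = right
... | no p | no q = off p q

s-involutive : (i : Fin m) (a : Fin (suc m)) → s i ⟨$⟩ʳ (s i ⟨$⟩ʳ a) ≡ a
s-involutive i a with place i a
... | left = trans (cong (s i ⟨$⟩ʳ_) (s-left i)) (s-right i)
... | right = trans (cong (s i ⟨$⟩ʳ_) (s-right i)) (s-left i)
... | off p q = trans (cong (s i ⟨$⟩ʳ_) (s-fix i p q)) (s-fix i p q)

s-inverts : (i : Fin m) {a c : Fin (suc m)} → a ≺ c → s i ⟨$⟩ʳ c ≺ s i ⟨$⟩ʳ a →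
            a ≡ inject₁ i × c ≡ suc i
s-inverts i {a} {c} a≺c sc≺sa with place i a | place i c
... | left | right = refl , refl
... | left | left = contradiction a≺c (<-irrefl refl)
... | right | right = contradiction a≺c (<-irrefl refl)
... | right | left = contradiction (<-trans a≺c (inject₁≺suc i)) (<-irrefl refl)
... | left | off p q with ≺suc i (subst₂ _≺_ (s-fix i p q) (s-left i) sc≺sa)
...   | inj₁ e = contradiction e p
...   | inj₂ c≺l = contradiction (<-trans a≺c c≺l) (<-irrefl refl)
s-inverts i {a} {c} a≺c sc≺sa | right | off p q =
  contradiction (<-trans (inject₁≺suc i) (<-trans a≺c c≺l)) (<-irrefl refl)
  where c≺l = subst₂ _≺_ (s-fix i p q) (s-right i) sc≺sa
s-inverts i {a} {c} a≺c sc≺sa | off p q | left =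
  contradiction (<-trans (inject₁≺suc i) (<-trans r≺a a≺c)) (<-irrefl refl)
  where r≺a = subst₂ _≺_ (s-left i) (s-fix i p q) sc≺sa
s-inverts i {a} {c} a≺c sc≺sa | off p q | right with ≺suc i a≺c
... | inj₁ e = contradiction e p
... | inj₂ a≺l =
  contradiction (<-trans a≺l (subst₂ _≺_ (s-right i) (s-fix i p q) sc≺sa)) (<-irrefl refl)
s-inverts i {a} {c} a≺c sc≺sa | off p q | off p′ q′ =
  contradiction (<-trans a≺c (subst₂ _≺_ (s-fix i p′ q′) (s-fix i p q) sc≺sa)) (<-irrefl refl)

⟨$⟩ʳ-injective : (x : W m) {a c : Fin (suc m)} → x ⟨$⟩ʳ a ≡ x ⟨$⟩ʳ c → a ≡ c
⟨$⟩ʳ-injective x e = trans (sym (inverseˡ x)) (trans (cong (x ⟨$⟩ˡ_) e) (inverseˡ x))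

Descent : W m → Fin m → Set
Descent x k = x ⟨$⟩ʳ suc k ≺ x ⟨$⟩ʳ inject₁ k

Ascent : W m → Fin m → Set
Ascent x k = x ⟨$⟩ʳ inject₁ k ≺ x ⟨$⟩ʳ suc k

¬descent⇒ascent : (x : W m) (k : Fin m) → ¬ Descent x k → Ascent x k
¬descent⇒ascent x k ¬d with Finₚ.<-cmp (x ⟨$⟩ʳ inject₁ k) (x ⟨$⟩ʳ suc k)
... | tri< p _ _ = p
... | tri> _ _ p = contradiction p ¬d
... | tri≈ _ e _ = contradiction (inject₁≺suc k) (<-irrefl (cong toℕ (⟨$⟩ʳ-injective x e)))

¬ascent⇒descent : (x : W m) (k : Fin m) → ¬ Ascent x k → Descent x k
¬ascent⇒descent x k ¬a with Finₚ.<-cmp (x ⟨$⟩ʳ inject₁ k) (x ⟨$⟩ʳ suc k)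
... | tri< p _ _ = contradiction p ¬a
... | tri> _ _ p = p
... | tri≈ _ e _ = contradiction (inject₁≺suc k) (<-irrefl (cong toℕ (⟨$⟩ʳ-injective x e)))

-- Strict growth gives `a ≤ x a` when counted up from the first position and `x a ≤ a` when counted
-- down from the last.
ascending⇒id : (x : W m) → (∀ k → Ascent x k) → x ≈ 1ᵂ
ascending⇒id {m} x asc a = Finₚ.toℕ-injective (≤-antisym (upper a) (lower a))
  where
  lower : ∀ a → toℕ a ≤ toℕ (x ⟨$⟩ʳ a)
  lower = <-weakInduction (λ a → toℕ a ≤ toℕ (x ⟨$⟩ʳ a)) z≤n λ k p →
    ≤-trans (s≤s (subst (_≤ toℕ (x ⟨$⟩ʳ inject₁ k)) (Finₚ.toℕ-inject₁ k) p)) (asc k)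
  upper : ∀ a → toℕ (x ⟨$⟩ʳ a) ≤ toℕ a
  upper = >-weakInduction (λ a → toℕ (x ⟨$⟩ʳ a) ≤ toℕ a)
    (subst (toℕ (x ⟨$⟩ʳ fromℕ m) ≤_) (sym (Finₚ.toℕ-fromℕ m)) (≤-pred (Finₚ.toℕ<n (x ⟨$⟩ʳ fromℕ m))))
    λ k p → subst (toℕ (x ⟨$⟩ʳ inject₁ k) ≤_) (sym (Finₚ.toℕ-inject₁ k)) (≤-pred (≤-trans (asc k) p))

descent? : (x : W m) → ∃ (Descent x) ⊎ x ≈ 1ᵂ
descent? x with Finₚ.any? (λ k → (x ⟨$⟩ʳ suc k) Fin.<? (x ⟨$⟩ʳ inject₁ k))
... | yes d = inj₁ d
... | no ¬d = inj₂ (ascending⇒id x λ k → ¬descent⇒ascent x k λ d → ¬d (k , d))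

⟦⟧-++ : (u v : List (Fin m)) → ⟦ u ++ v ⟧ ≈ ⟦ u ⟧ · ⟦ v ⟧
⟦⟧-++ [] v a = refl
⟦⟧-++ (i ∷ u) v a = cong (s i ⟨$⟩ʳ_) (⟦⟧-++ u v a)

⟦⟧-∷ʳ : (u : List (Fin m)) (k : Fin m) → ⟦ u ++ k ∷ [] ⟧ ≈ ⟦ u ⟧ · s k
⟦⟧-∷ʳ u k = ⟦⟧-++ u (k ∷ [])

length-∷ʳ : ∀ {A : Set} (u : List A) k → length (u ++ k ∷ []) ≡ suc (length u)
length-∷ʳ u k = trans (length-++ u) (+-comm (length u) 1)

ℓ-≤-word : (x : W m) (u : List (Fin m)) → ⟦ u ⟧ ≈ x → ℓ x ≤ length u
ℓ-≤-word x u e = ℓ-minimal x (length u) (u , refl , e)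

ℓ-≤ : (x y : W m) → x ≈ y → ℓ x ≤ ℓ y
ℓ-≤ x y x≈y with ℓ-word y
... | u , len , e = subst (ℓ x ≤_) len (ℓ-≤-word x u λ a → trans (e a) (sym (x≈y a)))

ℓ-cong : (x y : W m) → x ≈ y → ℓ x ≡ ℓ y
ℓ-cong x y x≈y = ≤-antisym (ℓ-≤ x y x≈y) (ℓ-≤ y x (sym ∘ x≈y))

ℓ-· : (x y : W m) → ℓ (x · y) ≤ ℓ x + ℓ y
ℓ-· x y with ℓ-word x | ℓ-word y
... | u , lu , eu | v , lv , ev =
  subst (ℓ (x · y) ≤_) (trans (length-++ u) (cong₂ _+_ lu lv))
    (ℓ-≤-word (x · y) (u ++ v) λ a →
      trans (⟦⟧-++ u v a) (trans (cong (⟦ u ⟧ ⟨$⟩ʳ_) (ev a)) (eu _)))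

ℓ-s : (k : Fin m) → ℓ (s k) ≤ 1
ℓ-s k = ℓ-≤-word (s k) (k ∷ []) λ _ → refl

ℓ-id : (x : W m) → x ≈ 1ᵂ → ℓ x ≡ 0
ℓ-id x e = n≤0⇒n≡0 (ℓ-≤-word x [] (sym ∘ e))

ℓ-s· : (k : Fin m) (x : W m) → ℓ (s k · x) ≤ suc (ℓ x)
ℓ-s· k x = ≤-trans (ℓ-· (s k) x) (+-monoˡ-≤ (ℓ x) (ℓ-s k))

ℓ-·s : (x : W m) (k : Fin m) → ℓ (x · s k) ≤ suc (ℓ x)
ℓ-·s x k = ≤-trans (ℓ-· x (s k)) (≤-trans (+-monoʳ-≤ (ℓ x) (ℓ-s k)) (≤-reflexive (+-comm (ℓ x) 1)))

-- Deleting the letter at which the word first inverts the values at k and k + 1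
-- multiplies the word by s k.
word-exchange : (u : List (Fin m)) (k : Fin m) → Descent ⟦ u ⟧ k →
                ∃[ v ] (length u ≡ suc (length v) × ⟦ v ⟧ ≈ ⟦ u ⟧ · s k)
word-exchange [] k d = contradiction (<-trans d (inject₁≺suc k)) (<-irrefl refl)
word-exchange (i ∷ u) k d with (⟦ u ⟧ ⟨$⟩ʳ suc k) Fin.<? (⟦ u ⟧ ⟨$⟩ʳ inject₁ k)
... | yes d′ with word-exchange u k d′
...   | v , len , e = i ∷ v , cong suc len , cong (s i ⟨$⟩ʳ_) ∘ e
word-exchange (i ∷ u) k d | no ¬d with s-inverts i (¬descent⇒ascent ⟦ u ⟧ k ¬d) d
... | lo , hi = u , refl , conjugate
  where
  conjugate : ⟦ u ⟧ ≈ s i · ⟦ u ⟧ · s k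
  conjugate a with place k a
  ... | left = trans lo (sym (trans (cong (λ b → s i ⟨$⟩ʳ (⟦ u ⟧ ⟨$⟩ʳ b)) (s-left k))
                             (trans (cong (s i ⟨$⟩ʳ_) hi) (s-right i))))
  ... | right = trans hi (sym (trans (cong (λ b → s i ⟨$⟩ʳ (⟦ u ⟧ ⟨$⟩ʳ b)) (s-right k))
                              (trans (cong (s i ⟨$⟩ʳ_) lo) (s-left i))))
  ... | off p q = sym (trans (cong (λ b → s i ⟨$⟩ʳ (⟦ u ⟧ ⟨$⟩ʳ b)) (s-fix k p q))
      (s-fix i (λ e → p (⟨$⟩ʳ-injective ⟦ u ⟧ (trans e (sym lo))))
               (λ e → q (⟨$⟩ʳ-injective ⟦ u ⟧ (trans e (sym hi))))))

descent-s : (x : W m) (k : Fin m) → Descent x k → Ascent (x · s k) k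
descent-s x k = subst₂ (λ a b → x ⟨$⟩ʳ a ≺ x ⟨$⟩ʳ b) (sym (s-left k)) (sym (s-right k))

ascent-s : (x : W m) (k : Fin m) → Ascent x k → Descent (x · s k) k
ascent-s x k = subst₂ (λ a b → x ⟨$⟩ʳ a ≺ x ⟨$⟩ʳ b) (sym (s-right k)) (sym (s-left k))

·s·s : (x : W m) (k : Fin m) → x · s k · s k ≈ x
·s·s x k a = cong (x ⟨$⟩ʳ_) (s-involutive k a)

-- The exchange property, applied to a shortest word of `x`, leaves a word for `x · s k` with one
-- letter fewer. This links length to the order of values.
ℓ-descent : (x : W m) (k : Fin m) → Descent x k → ℓ x ≡ suc (ℓ (x · s k))
ℓ-descent x k d = ≤-antisym
  (≤-trans (ℓ-≤ x (x · s k · s k) (sym ∘ ·s·s x k)) (ℓ-·s (x · s k) k)) shorter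
  where
  shorter : suc (ℓ (x · s k)) ≤ ℓ x
  shorter with ℓ-word x
  ... | u , lu , eu with word-exchange u k (subst₂ _≺_ (sym (eu _)) (sym (eu _)) d)
  ...   | v , lv , ev = subst (suc (ℓ (x · s k)) ≤_) (trans (sym lv) lu)
            (s≤s (ℓ-≤-word (x · s k) v λ a → trans (ev a) (eu _)))

ℓ-ascent : (x : W m) (k : Fin m) → Ascent x k → ℓ (x · s k) ≡ suc (ℓ x)
ℓ-ascent x k d = trans (ℓ-descent (x · s k) k (ascent-s x k d))
                       (cong suc (ℓ-cong (x · s k · s k) x (·s·s x k)))

-- The inversion criterion for `ℓ (x · y) ≡ ℓ x + ℓ y`; the equivalence is the content of the two
-- lemmas on additivity below.
KeepsInversions : W m → W m → Set
KeepsInversions x y = ∀ a c → a ≺ c → y ⟨$⟩ʳ c ≺ y ⟨$⟩ʳ a → (x · y) ⟨$⟩ʳ c ≺ (x · y) ⟨$⟩ʳ a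

s-order : (y : W m) (k : Fin m) → Descent y k → ∀ a c → a ≺ c →
          (y · s k) ⟨$⟩ʳ c ≺ (y · s k) ⟨$⟩ʳ a → s k ⟨$⟩ʳ a ≺ s k ⟨$⟩ʳ c
s-order y k d a c a≺c inv with Finₚ.<-cmp (s k ⟨$⟩ʳ a) (s k ⟨$⟩ʳ c)
... | tri< p _ _ = p
... | tri≈ _ e _ = contradiction a≺c (<-irrefl (cong toℕ (⟨$⟩ʳ-injective (s k) e)))
... | tri> _ _ p with s-inverts k a≺c p
...   | refl , refl = contradiction (<-trans inv (descent-s y k d)) (<-irrefl refl)

-- A descent of `y` is then a descent of `x · y` as well, so removing it on the right shortens both
-- by one. By `s-order` the hypothesis survives the removal.
keepsInversions⇒additive : (x y : W m) → KeepsInversions x y → ℓ (x · y) ≡ ℓ x + ℓ y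
keepsInversions⇒additive x y = go (ℓ y) y refl
  where
  go : ∀ n y → ℓ y ≡ n → KeepsInversions x y → ℓ (x · y) ≡ ℓ x + ℓ y
  go n y ly≡n keeps with descent? y
  ... | inj₂ y≈1 = trans (ℓ-cong (x · y) x (cong (x ⟨$⟩ʳ_) ∘ y≈1))
                         (sym (trans (cong (ℓ x +_) (ℓ-id y y≈1)) (+-identityʳ (ℓ x))))
  go zero y ly≡0 keeps | inj₁ (k , d) =
    contradiction (trans (sym ly≡0) (ℓ-descent y k d)) λ ()
  go (suc n) y ly≡n keeps | inj₁ (k , d) = begin
    ℓ (x · y)               ≡⟨ ℓ-descent (x · y) k (keeps _ _ (inject₁≺suc k) d) ⟩
    suc (ℓ (x · y · s k))   ≡⟨ cong suc (ℓ-cong (x · y · s k) (x · (y · s k)) λ _ → refl) ⟩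
    suc (ℓ (x · (y · s k))) ≡⟨ cong suc (go n (y · s k) shorter keeps′) ⟩
    suc (ℓ x + ℓ (y · s k)) ≡⟨ +-suc (ℓ x) _ ⟨
    ℓ x + suc (ℓ (y · s k)) ≡⟨ cong (ℓ x +_) (ℓ-descent y k d) ⟨
    ℓ x + ℓ y               ∎
    where
    open ≡-Reasoning
    shorter : ℓ (y · s k) ≡ n
    shorter = suc-injective (trans (sym (ℓ-descent y k d)) ly≡n)
    keeps′ : KeepsInversions x (y · s k)
    keeps′ a c a≺c inv = keeps _ _ (s-order y k d a c a≺c inv) inv

-- Subadditivity of `ℓ` carries additivity over to `y · s k` for a descent `k` of `y`, and then
-- forces `k` to be a descent of `x · y`. The other inversions of `y` are inherited from `y · s k`.
additive⇒keepsInversions : (x y : W m) → ℓ (x · y) ≡ ℓ x + ℓ y → KeepsInversions x y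
additive⇒keepsInversions x y = go (ℓ y) y refl
  where
  go : ∀ n y → ℓ y ≡ n → ℓ (x · y) ≡ ℓ x + ℓ y → KeepsInversions x y
  go n y ly≡n add a c a≺c inv with descent? y
  ... | inj₂ y≈1 = contradiction (<-trans a≺c (subst₂ _≺_ (y≈1 c) (y≈1 a) inv)) (<-irrefl refl)
  go zero y ly≡0 add a c a≺c inv | inj₁ (k , d) =
    contradiction (trans (sym ly≡0) (ℓ-descent y k d)) λ ()
  go (suc n) y ly≡n add a c a≺c inv | inj₁ (k , d) = keeps
    where
    y′ = y · s k

    lower : ℓ x + ℓ y ≤ suc (ℓ (x · y′))
    lower = subst (_≤ suc (ℓ (x · y′)))
      (trans (ℓ-cong (x · y′ · s k) (x · y) (cong (x ⟨$⟩ʳ_) ∘ ·s·s y k)) add)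
      (ℓ-·s (x · y′) k)

    add′ : ℓ (x · y′) ≡ ℓ x + ℓ y′
    add′ = ≤-antisym (ℓ-· x y′) (≤-pred (subst (_≤ suc (ℓ (x · y′)))
      (trans (cong (ℓ x +_) (ℓ-descent y k d)) (+-suc (ℓ x) _)) lower))

    keeps′ : KeepsInversions x y′
    keeps′ = go n y′ (suc-injective (trans (sym (ℓ-descent y k d)) ly≡n)) add′

    xy-descent : Descent (x · y) k
    xy-descent = ¬ascent⇒descent (x · y) k λ asc →
      <-irrefl (trans (trans (sym add′) (sym (ℓ-cong (x · y · s k) (x · y′) λ _ → refl)))
               (trans (ℓ-ascent (x · y) k asc) (cong suc (trans add (cong (ℓ x +_) (ℓ-descent y k d))))))
        (≤-trans (n<1+n _) (s≤s (+-monoʳ-≤ (ℓ x) (n≤1+n _))))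

    back : ∀ z → (y′ ⟨$⟩ʳ (s k ⟨$⟩ʳ z)) ≡ y ⟨$⟩ʳ z
    back z = cong (y ⟨$⟩ʳ_) (s-involutive k z)

    keeps : (x · y) ⟨$⟩ʳ c ≺ (x · y) ⟨$⟩ʳ a
    keeps with Finₚ.<-cmp (s k ⟨$⟩ʳ a) (s k ⟨$⟩ʳ c)
    ... | tri≈ _ e _ = contradiction a≺c (<-irrefl (cong toℕ (⟨$⟩ʳ-injective (s k) e)))
    ... | tri< p _ _ = subst₂ (λ u v → x ⟨$⟩ʳ u ≺ x ⟨$⟩ʳ v) (back c) (back a)
            (keeps′ _ _ p (subst₂ _≺_ (sym (back c)) (sym (back a)) inv))
    ... | tri> _ _ p with s-inverts k a≺c p
    ...   | refl , refl = xy-descent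

-- Every pair is an inversion of `w₀`, so in the factorisation `w₀ · y ⁻¹ · y` of it no inversion of
-- `y` is lost and lengths add. This is the bound that makes `climb` terminate.
ℓ-reverse-max : (y : W m) → ℓ y ≤ ℓ {m} Perm.reverse
ℓ-reverse-max {m} y = ≤-trans (m≤n+m (ℓ y) (ℓ (w₀ · y ⁻¹))) (≤-reflexive (sym additive))
  where
  w₀ : W m
  w₀ = Perm.reverse
  cancel : w₀ · y ⁻¹ · y ≈ w₀
  cancel a = cong opposite (inverseˡ y)
  opposite-antitone : ∀ {a c : Fin (suc m)} → a ≺ c → opposite c ≺ opposite a
  opposite-antitone {a} {c} p = subst₂ _<_ (sym (Finₚ.opposite-prop c)) (sym (Finₚ.opposite-prop a))
    (∸-monoʳ-< (s≤s p) (Finₚ.toℕ<n c))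
  additive : ℓ w₀ ≡ ℓ (w₀ · y ⁻¹) + ℓ y
  additive = trans (ℓ-cong w₀ (w₀ · y ⁻¹ · y) (sym ∘ cancel))
    (keepsInversions⇒additive (w₀ · y ⁻¹) y λ a c a≺c _ →
      subst₂ _≺_ (sym (cancel c)) (sym (cancel a)) (opposite-antitone a≺c))

-- Blocks

-- The maximal runs of J cut the positions 0, …, m into blocks, numbered from 0.
block : Subset m → Fin (suc m) → ℕ
block J zero = 0
block (inside ∷ J) (suc a) = block J a
block (outside ∷ J) (suc a) = suc (block J a)

block-∈ : {j : Fin m} → j ∈ J → block J (suc j) ≡ block J (inject₁ j)
block-∈ {J = inside ∷ J} here = refl
block-∈ {J = inside ∷ J} (there p) = block-∈ p
block-∈ {J = outside ∷ J} (there p) = cong suc (block-∈ p)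

block-∉ : {j : Fin m} → j ∉ J → block J (suc j) ≡ suc (block J (inject₁ j))
block-∉ {J = inside ∷ J} {zero} p = contradiction here p
block-∉ {J = outside ∷ J} {zero} p = refl
block-∉ {J = inside ∷ J} {suc j} p = block-∉ (p ∘ there)
block-∉ {J = outside ∷ J} {suc j} p = cong suc (block-∉ (p ∘ there))

block-mono : (J : Subset m) {a c : Fin (suc m)} → toℕ a ≤ toℕ c → block J a ≤ block J c
block-mono J {zero} _ = z≤n
block-mono (inside ∷ J) {suc a} {suc c} (s≤s p) = block-mono J p
block-mono (outside ∷ J) {suc a} {suc c} (s≤s p) = s≤s (block-mono J p)

block-cancel-< : (J : Subset m) {a c : Fin (suc m)} → block J a < block J c → a ≺ c
block-cancel-< J p = ≰⇒> λ q → <⇒≱ p (block-mono J q)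

block-injective : (I J : Subset m) → (∀ a → block I a ≡ block J a) → I ≡ J
block-injective [] [] e = refl
block-injective (inside ∷ I) (inside ∷ J) e = cong (inside ∷_) (block-injective I J (e ∘ suc))
block-injective (outside ∷ I) (outside ∷ J) e =
  cong (outside ∷_) (block-injective I J (suc-injective ∘ e ∘ suc))
block-injective (inside ∷ I) (outside ∷ J) e = contradiction (e (suc zero)) λ ()
block-injective (outside ∷ I) (inside ∷ J) e = contradiction (e (suc zero)) λ ()

block-remove-≤ : {d : Fin m} {a : Fin (suc m)} → d ∈ J → toℕ a ≤ toℕ d →
                 block (J - d) a ≡ block J a
block-remove-≤ {a = zero} d∈J _ = refl
block-remove-≤ {J = inside ∷ J} {d = suc d} {suc a} (there p) (s≤s q) = block-remove-≤ p q
block-remove-≤ {J = outside ∷ J} {d = suc d} {suc a} (there p) (s≤s q) =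
  cong suc (block-remove-≤ p q)

block-remove-> : {d : Fin m} {a : Fin (suc m)} → d ∈ J → toℕ d < toℕ a →
                 block (J - d) a ≡ suc (block J a)
block-remove-> {J = inside ∷ J} {zero} {suc a} here _ =
  cong (λ X → suc (block X a)) (p─⊥≡p J)
block-remove-> {J = inside ∷ J} {suc d} {suc a} (there p) (s≤s q) = block-remove-> p q
block-remove-> {J = outside ∷ J} {suc d} {suc a} (there p) (s≤s q) =
  cong suc (block-remove-> p q)

∪-remove : (I : Subset m) {d : Fin m} → d ∉ I → (I ∪ ⁅ d ⁆) - d ≡ I
∪-remove (inside ∷ I) {zero} p = contradiction here p
∪-remove (outside ∷ I) {zero} p =
  cong (outside ∷_) (trans (p─⊥≡p (I ∪ ⊥)) (∪-identityʳ I))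
∪-remove (inside ∷ I) {suc d} p = cong (inside ∷_) (∪-remove I (p ∘ there))
∪-remove (outside ∷ I) {suc d} p = cong (outside ∷_) (∪-remove I (p ∘ there))

-- States that the `k`-th gap separates block `k` from block `k + 1`, in a form that starts at any
-- `n` and so survives the shift by `map suc` in the recursion over `J`.
data Numbered (J : Subset m) : ℕ → List (Fin m) → Set where
  []  : ∀ {n} → Numbered J n []
  _∷_ : ∀ {n d ds} → d ∉ J × block J (inject₁ d) ≡ n → Numbered J (suc n) ds →
        Numbered J n (d ∷ ds)

Numbered-inside : ∀ {n ds} → Numbered J n ds → Numbered (inside ∷ J) n (map suc ds)
Numbered-inside [] = []
Numbered-inside ((d∉J , e) ∷ ns) = ((λ { (there p) → d∉J p }) , e) ∷ Numbered-inside ns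

Numbered-outside : ∀ {n ds} → Numbered J n ds → Numbered (outside ∷ J) (suc n) (map suc ds)
Numbered-outside [] = []
Numbered-outside ((d∉J , e) ∷ ns) =
  ((λ { (there p) → d∉J p }) , cong suc e) ∷ Numbered-outside ns

Numbered-lookup : ∀ {n ds} → Numbered J n ds → (k : Fin (length ds)) →
                  lookup ds k ∉ J × block J (inject₁ (lookup ds k)) ≡ n + toℕ k
Numbered-lookup {n = n} ((p , e) ∷ _) zero = p , trans e (sym (+-identityʳ n))
Numbered-lookup {n = n} (_ ∷ ns) (suc k) with Numbered-lookup ns k
... | p , e = p , trans e (sym (+-suc n (toℕ k)))

filter-∉-map-suc : ∀ b (J : Subset m) xs →
                   filter (λ i → ¬? (i ∈? (b ∷ J))) (map suc xs) ≡
                   map suc (filter (λ i → ¬? (i ∈? J)) xs)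
filter-∉-map-suc b J [] = refl
filter-∉-map-suc b J (x ∷ xs) with does (x ∈? J)
... | inside = filter-∉-map-suc b J xs
... | outside = cong (suc x ∷_) (filter-∉-map-suc b J xs)

gaps-tail : ∀ b (J : Subset m) →
            filter (λ i → ¬? (i ∈? (b ∷ J))) (tabulate suc) ≡ map suc (gaps J)
gaps-tail b J = trans (cong (filter _) (sym (map-tabulate id suc))) (filter-∉-map-suc b J (allFin _))

gaps-numbered : (J : Subset m) → Numbered J 0 (gaps J)
gaps-numbered [] = []
gaps-numbered (inside ∷ J) rewrite gaps-tail inside J = Numbered-inside (gaps-numbered J)
gaps-numbered (outside ∷ J) rewrite gaps-tail outside J =
  ((λ ()) , refl) ∷ Numbered-outside (gaps-numbered J)

length-gaps : (J : Subset m) → length (gaps J) ≡ block J (fromℕ m)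
length-gaps [] = refl
length-gaps (inside ∷ J) rewrite gaps-tail inside J =
  trans (length-map suc (gaps J)) (length-gaps J)
length-gaps (outside ∷ J) rewrite gaps-tail outside J =
  cong suc (trans (length-map suc (gaps J)) (length-gaps J))

block-surjective : (J : Subset m) {k : ℕ} → k ≤ length (gaps J) → ∃[ a ] block J a ≡ k
block-surjective {m} J {k} k≤ with m≤n⇒m<n∨m≡n k≤
... | inj₂ e = fromℕ m , trans (sym (length-gaps J)) (sym e)
... | inj₁ k< = inject₁ (lookup (gaps J) (Fin.fromℕ< k<)) ,
  trans (proj₂ (Numbered-lookup (gaps-numbered J) (Fin.fromℕ< k<))) (Finₚ.toℕ-fromℕ< k<)

length-gaps-remove : {d : Fin m} → d ∈ J → length (gaps (J - d)) ≡ suc (length (gaps J))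
length-gaps-remove {m} {J} {d} d∈J = trans (length-gaps (J - d))
  (trans (block-remove-> d∈J (subst (toℕ d <_) (sym (Finₚ.toℕ-fromℕ m)) (Finₚ.toℕ<n d)))
         (cong suc (sym (length-gaps J))))

s-block : {j : Fin m} → j ∈ J → ∀ a → block J (s j ⟨$⟩ʳ a) ≡ block J a
s-block {J = J} {j} j∈J a with place j a
... | left = trans (cong (block J) (s-left j)) (block-∈ j∈J)
... | right = trans (cong (block J) (s-right j)) (sym (block-∈ j∈J))
... | off p q = cong (block J) (s-fix j p q)

-- x carries the blocks of J onto those of I, and the block numbered b of I comes
-- from the block numbered g b of J.
PermutesBlocks : (ℕ → ℕ) → Subset m → Subset m → W m → Set
PermutesBlocks g I J x = ∀ a → g (block I (x ⟨$⟩ʳ a)) ≡ block J a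

PreservesBlocks : Subset m → W m → Set
PreservesBlocks J = PermutesBlocks id J J

DecreasingOn : Subset m → W m → Set
DecreasingOn J x = ∀ j → j ∈ J → Descent x j

∈⟨⟩⇒preservesBlocks : (x : W m) → x ∈⟨ J ⟩ → PreservesBlocks J x
∈⟨⟩⇒preservesBlocks {J = J} x (u , u⊆J , e) a = trans (cong (block J) (sym (e a))) (go u u⊆J a)
  where
  go : ∀ u → All (_∈ J) u → PreservesBlocks J ⟦ u ⟧
  go [] [] a = refl
  go (i ∷ u) (i∈J ∷ u⊆J) a = trans (s-block i∈J (⟦ u ⟧ ⟨$⟩ʳ a)) (go u u⊆J a)

-- Letters are stripped off on the right at descents. A descent outside `J` would put the image of a
-- later block below that of an earlier one. Reducedness of the word is kept for evaluating the
-- 0-Hecke product.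
preservesBlocks⇒reducedWord : (x : W m) → PreservesBlocks J x →
                              ∃[ u ] (All (_∈ J) u × IsReducedWord u x)
preservesBlocks⇒reducedWord {J = J} x = go (ℓ x) x refl
  where
  go : ∀ n x → ℓ x ≡ n → PreservesBlocks J x → ∃[ u ] (All (_∈ J) u × IsReducedWord u x)
  go n x lx≡n pres with descent? x
  ... | inj₂ x≈1 = [] , [] , sym ∘ x≈1 , sym (ℓ-id x x≈1)
  go zero x lx≡n pres | inj₁ (k , d) =
    contradiction (trans (sym lx≡n) (ℓ-descent x k d)) λ ()
  go (suc n) x lx≡n pres | inj₁ (k , d) with k ∈? J
  ... | no k∉J = contradiction
        (subst₂ _≤_ (trans (pres (suc k)) (block-∉ k∉J)) (pres (inject₁ k))
                    (block-mono J (<⇒≤ d))) (<-irrefl refl)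
  ... | yes k∈J with go n (x · s k) (suc-injective (trans (sym (ℓ-descent x k d)) lx≡n))
                       (λ a → trans (pres (s k ⟨$⟩ʳ a)) (s-block k∈J a))
  ...   | u , u⊆J , e , len =
    u ++ k ∷ [] , All.++⁺ u⊆J (k∈J ∷ []) ,
    (λ a → trans (⟦⟧-∷ʳ u k a) (trans (e (s k ⟨$⟩ʳ a)) (·s·s x k a))) ,
    trans (length-∷ʳ u k) (trans (cong suc len) (sym (ℓ-descent x k d)))

preservesBlocks⇒∈⟨⟩ : (x : W m) → PreservesBlocks J x → x ∈⟨ J ⟩
preservesBlocks⇒∈⟨⟩ x pres with preservesBlocks⇒reducedWord x pres
... | u , u⊆J , e , _ = u , u⊆J , e

preservesBlocks-⁻¹ : (x : W m) → PreservesBlocks J x → PreservesBlocks J (x ⁻¹)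
preservesBlocks-⁻¹ {J = J} x pres a =
  trans (sym (pres (x ⟨$⟩ˡ a))) (cong (block J) (inverseʳ x))

permutesBlocks-·s : (x : W m) {j : Fin m} → j ∈ J → PermutesBlocks g I J x →
                    PermutesBlocks g I J (x · s j)
permutesBlocks-·s x {j} j∈J perm a = trans (perm (s j ⟨$⟩ʳ a)) (s-block j∈J a)

-- Double cosets as sets of block-permuting elements

module _ {m} {I J : Subset m} (p : Coset I J) where

  ∈ᶜ⇒permutesBlocks : PermutesBlocks g I J (rep p) → (x : W m) → x ∈ᶜ p →
                      PermutesBlocks g I J x
  ∈ᶜ⇒permutesBlocks {g = g} perm x (u , v , u∈I , v∈J , e) a =
    trans (cong (g ∘ block I) (e a))
    (trans (cong g (∈⟨⟩⇒preservesBlocks u u∈I _))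
    (trans (perm (v ⟨$⟩ʳ a)) (∈⟨⟩⇒preservesBlocks v v∈J a)))

  permutesBlocks-rep : (x : W m) → x ∈ᶜ p → PermutesBlocks g I J x →
                       PermutesBlocks g I J (rep p)
  permutesBlocks-rep {g = g} x (u , v , u∈I , v∈J , e) perm a = begin
    g (block I (rep p ⟨$⟩ʳ a))         ≡⟨ cong (λ b → g (block I (rep p ⟨$⟩ʳ b))) (inverseʳ v) ⟨
    g (block I ((rep p · v) ⟨$⟩ʳ b))   ≡⟨ cong g (∈⟨⟩⇒preservesBlocks u u∈I _) ⟨
    g (block I ((u · rep p · v) ⟨$⟩ʳ b)) ≡⟨ cong (g ∘ block I) (e b) ⟨
    g (block I (x ⟨$⟩ʳ b))             ≡⟨ perm b ⟩
    block J b                           ≡⟨ preservesBlocks-⁻¹ v (∈⟨⟩⇒preservesBlocks v v∈J) a ⟩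
    block J a                           ∎
    where
    open ≡-Reasoning
    b = v ⟨$⟩ˡ a

  permutesBlocks⇒∈ᶜ : PermutesBlocks g I J (rep p) → (x : W m) → PermutesBlocks g I J x → x ∈ᶜ p
  permutesBlocks⇒∈ᶜ {g = g} perm-p x perm-x =
    -- No factor from `I` is required: `rep p` and `x` follow the same `g`, so they differ on the
    -- right by an element preserving the blocks of `J`.
    1ᵂ , rep p ⁻¹ · x , ([] , [] , λ _ → refl) ,
    preservesBlocks⇒∈⟨⟩ (rep p ⁻¹ · x) (λ a →
      trans (sym (perm-p _)) (trans (cong (g ∘ block I) (inverseʳ (rep p))) (perm-x a))) ,
    λ a → sym (inverseʳ (rep p))

decreasing-block : (x : W m) → DecreasingOn J x → ∀ {a c} → a ≺ c → block J a ≡ block J c →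
                   x ⟨$⟩ʳ c ≺ x ⟨$⟩ʳ a
decreasing-block {m} {J} x dec {a} {c} = go c
  where
  P : Fin (suc m) → Set
  P c = a ≺ c → block J a ≡ block J c → x ⟨$⟩ʳ c ≺ x ⟨$⟩ʳ a
  step : ∀ j → P (inject₁ j) → P (suc j)
  step j ih a≺sj e with j ∈? J | ≺suc j a≺sj
  ... | yes j∈J | inj₁ refl = dec j j∈J
  ... | yes j∈J | inj₂ a≺j = <-trans (dec j j∈J) (ih a≺j (trans e (block-∈ j∈J)))
  ... | no j∉J | q = contradiction (trans e (block-∉ j∉J))
        (<⇒≢ (s≤s (block-mono J (a≤j q))))
    where
    a≤j : a ≡ inject₁ j ⊎ a ≺ inject₁ j → toℕ a ≤ toℕ (inject₁ j)
    a≤j (inj₁ e) = ≤-reflexive (cong toℕ e)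
    a≤j (inj₂ p) = <⇒≤ p
  go : ∀ c → P c
  go = <-weakInduction P (λ ()) step

-- y · x⁻¹ is increasing, hence trivial: x⁻¹ reverses each block and y reverses it
-- back, and the blocks themselves keep their order.
module _ {m} {I I′ J : Subset m} (inj : ∀ {a b} → g a ≡ g b → a ≡ b) (x y : W m)
         (x-perm : PermutesBlocks g I J x) (y-perm : PermutesBlocks g I′ J y)
         (x-dec : DecreasingOn J x) (y-dec : DecreasingOn J y) where

  private
    z : W m
    z = y · x ⁻¹

    z-block : ∀ a → block I′ (z ⟨$⟩ʳ a) ≡ block I a
    z-block a = inj (trans (y-perm (x ⟨$⟩ˡ a)) (trans (sym (x-perm (x ⟨$⟩ˡ a)))
                      (cong (g ∘ block I) (inverseʳ x))))

    x⁻¹-block : ∀ a → block J (x ⟨$⟩ˡ a) ≡ g (block I a)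
    x⁻¹-block a = trans (sym (x-perm (x ⟨$⟩ˡ a))) (cong (g ∘ block I) (inverseʳ x))

    x⁻¹-same-block : ∀ {k} → k ∈ I → block J (x ⟨$⟩ˡ inject₁ k) ≡ block J (x ⟨$⟩ˡ suc k)
    x⁻¹-same-block k∈I =
      trans (x⁻¹-block _) (trans (cong g (sym (block-∈ k∈I))) (sym (x⁻¹-block _)))

    z-ascent : ∀ k → Ascent z k
    z-ascent k with k ∈? I
    ... | no k∉I = block-cancel-< I′ (subst₂ _<_ (sym (z-block (inject₁ k)))
          (sym (trans (z-block (suc k)) (block-∉ k∉I))) (n<1+n _))
    ... | yes k∈I with Finₚ.<-cmp (x ⟨$⟩ˡ inject₁ k) (x ⟨$⟩ˡ suc k)
    ...   | tri> _ _ p = decreasing-block y y-dec p (sym (x⁻¹-same-block k∈I))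
    ...   | tri≈ _ e _ = contradiction (inject₁≺suc k)
            (<-irrefl (cong toℕ (⟨$⟩ʳ-injective (x ⁻¹) e)))
    ...   | tri< p _ _ = contradiction (inject₁≺suc k) (<-asym
            (subst₂ _≺_ (inverseʳ x) (inverseʳ x)
              (decreasing-block x x-dec p (x⁻¹-same-block k∈I))))

    z≈1 : z ≈ 1ᵂ
    z≈1 = ascending⇒id z z-ascent

  decreasing-unique : x ≈ y
  decreasing-unique a = trans (sym (z≈1 (x ⟨$⟩ʳ a))) (cong (y ⟨$⟩ʳ_) (inverseˡ x))

  -- Since `z` is trivial, `z-block` identifies the two block numberings. Thus `g` and `J` determine
  -- the left-hand subset.
  blocks-unique : I ≡ I′
  blocks-unique = block-injective I I′ λ a → trans (sym (z-block a)) (cong (block I′) (z≈1 a))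

-- Bruhat-maximal and longest elements

≤ᴮ⇒ℓ≤ : {x y : W m} → x ≤ᴮ y → ℓ x ≤ ℓ y
≤ᴮ⇒ℓ≤ {x = x} {y} (≤ᴮ-refl e) = ℓ-≤ x y e
≤ᴮ⇒ℓ≤ (≤ᴮ-step i j _ p q) = ≤-trans (<⇒≤ p) (≤ᴮ⇒ℓ≤ q)

≤ᴮ-resp : {x y z : W m} → x ≤ᴮ y → y ≈ z → x ≤ᴮ z
≤ᴮ-resp {z = z} (≤ᴮ-refl {x} {y} e) f = ≤ᴮ-refl {x = x} {y = z} λ a → trans (e a) (f a)
≤ᴮ-resp {z = z} (≤ᴮ-step {x} {y} {w} i j e p q) f =
  ≤ᴮ-step {x = x} {y = y} {z = z} i j e p (≤ᴮ-resp {x = y} {y = w} {z = z} q f)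

abstract

  -- As long as some `k` in `J` is an ascent, passing to `x · s k` is a Bruhat step up that keeps
  -- the block permutation.
  climb : (x : W m) → PermutesBlocks g I J x →
          ∃[ y ] (PermutesBlocks g I J y × DecreasingOn J y × x ≤ᴮ y)
  climb {m} {g} {I} {J} x = go (ℓ {m} Perm.reverse) x (m≤m+n _ (ℓ x))
    where
    go : ∀ n x → ℓ {m} Perm.reverse ≤ n + ℓ x → PermutesBlocks g I J x →
         ∃[ y ] (PermutesBlocks g I J y × DecreasingOn J y × x ≤ᴮ y)
    go n x bound perm with Finₚ.any? (λ k → (k ∈? J) ×-dec
                             ((x ⟨$⟩ʳ inject₁ k) Fin.<? (x ⟨$⟩ʳ suc k)))
    ... | no ¬asc = x , perm ,
      (λ j j∈J → ¬ascent⇒descent x j λ a → ¬asc (j , j∈J , a)) , ≤ᴮ-refl {x = x} {y = x} λ _ → refl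
    -- With no fuel left `x` already has the length of `reverse`, so a further ascent is impossible.
    go zero x bound perm | yes (k , k∈J , asc) = contradiction
      (≤-trans (ℓ-reverse-max (x · s k)) bound)
      (<⇒≱ (≤-reflexive (sym (ℓ-ascent x k asc))))
    go (suc n) x bound perm | yes (k , k∈J , asc)
        with go n (x · s k)
               (subst (ℓ {m} Perm.reverse ≤_) (trans (sym (+-suc n (ℓ x)))
                 (cong (n +_) (sym (ℓ-ascent x k asc)))) bound)
               (permutesBlocks-·s {g = g} {I = I} x k∈J perm)
    ... | y , y-perm , y-dec , le = y , y-perm , y-dec ,
      ≤ᴮ-step {x = x} {y = x · s k} {z = y} (inject₁ k) (suc k) (λ _ → refl)
        (≤-reflexive (sym (ℓ-ascent x k asc))) le

-- Climbing from any element of `p` ends at a decreasing one, which can only be `x`.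
decreasing⇒isMax : (p : Coset I J) → (∀ {a b} → g a ≡ g b → a ≡ b) →
                   PermutesBlocks g I J (rep p) →
                   (x : W m) → PermutesBlocks g I J x → DecreasingOn J x → IsMax p x
decreasing⇒isMax {m} {I} {J} {g} p inj perm x x-perm x-dec =
  permutesBlocks⇒∈ᶜ p {g = g} perm x x-perm , below
  where
  below : ∀ y → y ∈ᶜ p → y ≤ᴮ x
  below y y∈p with climb {g = g} y (∈ᶜ⇒permutesBlocks p {g = g} perm y y∈p)
  ... | y′ , y′-perm , y′-dec , y≤y′ = ≤ᴮ-resp {x = y} {y = y′} {z = x} y≤y′
        (decreasing-unique {g = g} inj y′ x y′-perm x-perm y′-dec x-dec)

isMax⇒decreasing : (p : Coset I J) → PermutesBlocks g I J (rep p) →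
                   (x : W m) → IsMax p x → DecreasingOn J x
isMax⇒decreasing {g = g} p perm x (x∈p , above) j j∈J = ¬ascent⇒descent x j λ asc →
  <⇒≱ (≤-reflexive (sym (ℓ-ascent x j asc)))
      (≤ᴮ⇒ℓ≤ (above (x · s j) (permutesBlocks⇒∈ᶜ p {g = g} perm (x · s j)
        (permutesBlocks-·s {g = g} x j∈J (∈ᶜ⇒permutesBlocks p {g = g} perm x x∈p)))))

isLongest⇒decreasing : (w : W m) → IsLongest J w → DecreasingOn J w
isLongest⇒decreasing {J = J} w (w∈J , longest) j j∈J = ¬ascent⇒descent w j λ asc →
  <⇒≱ (≤-reflexive (sym (ℓ-ascent w j asc)))
      (longest (w · s j) (preservesBlocks⇒∈⟨⟩ (w · s j)
        (permutesBlocks-·s {g = id} {I = J} w j∈J (∈⟨⟩⇒preservesBlocks w w∈J))))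

decreasing⇒isLongest : (w : W m) → PreservesBlocks J w → DecreasingOn J w → IsLongest J w
decreasing⇒isLongest {J = J} w w-pres w-dec = preservesBlocks⇒∈⟨⟩ w w-pres , longest
  where
  longest : ∀ x → x ∈⟨ J ⟩ → ℓ x ≤ ℓ w
  longest x x∈J with climb {g = id} x (∈⟨⟩⇒preservesBlocks x x∈J)
  ... | y , y-pres , y-dec , x≤y = ≤-trans (≤ᴮ⇒ℓ≤ x≤y)
        (ℓ-≤ y w (decreasing-unique id y w y-pres w-pres y-dec w-dec))

-- The inverse of `w` also preserves the blocks and decreases on them, so uniqueness identifies it
-- with `w`.
longest-involutive : (w : W m) → PreservesBlocks J w → DecreasingOn J w → ∀ a →
                     w ⟨$⟩ʳ (w ⟨$⟩ʳ a) ≡ a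
longest-involutive {J = J} w pres dec a =
  trans (decreasing-unique id w (w ⁻¹) pres pres′ dec dec′ (w ⟨$⟩ʳ a)) (inverseˡ w)
  where
  pres′ : PreservesBlocks J (w ⁻¹)
  pres′ = preservesBlocks-⁻¹ w pres
  dec′ : DecreasingOn J (w ⁻¹)
  dec′ j j∈J = ¬ascent⇒descent (w ⁻¹) j λ asc → <-asym (inject₁≺suc j)
    (subst₂ _≺_ (inverseʳ w) (inverseʳ w) (decreasing-block w dec asc
      (trans (pres′ (inject₁ j)) (trans (sym (block-∈ j∈J)) (sym (pres′ (suc j)))))))

-- Atomic cosets and their compositions

if-yes : ∀ {P : Set} {A : Set} {x y : A} (d : Dec P) → P → (if ⌊ d ⌋ then x else y) ≡ x
if-yes (yes _) _ = refl
if-yes (no ¬p) p = contradiction p ¬p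

if-no : ∀ {P : Set} {A : Set} {x y : A} (d : Dec P) → ¬ P → (if ⌊ d ⌋ then x else y) ≡ y
if-no (yes p) ¬p = contradiction p ¬p
if-no (no _) _ = refl

⋆ˢ-ascent : (i : Fin m) (y : W m) → ℓ y < ℓ (s i · y) → i ⋆ˢ y ≡ s i · y
⋆ˢ-ascent i y = if-yes (ℓ y <? ℓ (s i · y))

⋆ˢ-descent : (i : Fin m) (y : W m) → ℓ (s i · y) ≤ ℓ y → i ⋆ˢ y ≡ y
⋆ˢ-descent i y down = if-no (ℓ y <? ℓ (s i · y)) (≤⇒≯ down)

-- Additivity for the whole word passes to each of its suffixes, so every letter lengthens what it
-- is applied to and `_⋆ˢ_` always multiplies.
foldr-⋆ˢ-additive : (u : List (Fin m)) (y : W m) → ℓ (⟦ u ⟧ · y) ≡ length u + ℓ y →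
                    foldr _⋆ˢ_ y u ≈ ⟦ u ⟧ · y
foldr-⋆ˢ-additive [] y _ _ = refl
foldr-⋆ˢ-additive (i ∷ u) y add a = go a
  where
  Y Z : W _
  Y = ⟦ u ⟧ · y
  Z = foldr _⋆ˢ_ y u

  word-bound : ℓ Y ≤ length u + ℓ y
  word-bound = ≤-trans (ℓ-· ⟦ u ⟧ y) (+-monoˡ-≤ (ℓ y) (ℓ-≤-word ⟦ u ⟧ u λ _ → refl))

  add′ : ℓ (s i · Y) ≡ suc (length u + ℓ y)
  add′ = trans (ℓ-cong (s i · Y) (⟦ i ∷ u ⟧ · y) λ _ → refl) add

  ih : Z ≈ Y
  ih = foldr-⋆ˢ-additive u y
    (≤-antisym word-bound (≤-pred (subst (_≤ suc (ℓ Y)) add′ (ℓ-s· i Y))))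

  up : ℓ Z < ℓ (s i · Z)
  up = subst₂ _<_ (sym (ℓ-cong Z Y ih))
    (sym (trans (ℓ-cong (s i · Z) (s i · Y) (cong (s i ⟨$⟩ʳ_) ∘ ih)) add′)) (s≤s word-bound)

  go : i ⋆ˢ Z ≈ ⟦ i ∷ u ⟧ · y
  go a = trans (cong (_⟨$⟩ʳ a) (⋆ˢ-ascent i Z up)) (cong (s i ⟨$⟩ʳ_) (ih a))

foldr-⋆ˢ-absorbed : (u : List (Fin m)) (y : W m) → All (_∈ I) u →
                    (∀ i → i ∈ I → ℓ (s i · y) ≤ ℓ y) → foldr _⋆ˢ_ y u ≈ y
foldr-⋆ˢ-absorbed [] y _ _ _ = refl
foldr-⋆ˢ-absorbed (i ∷ u) y (i∈I ∷ u⊆I) down = go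
  where
  Z : W _
  Z = foldr _⋆ˢ_ y u
  ih : Z ≈ y
  ih = foldr-⋆ˢ-absorbed u y u⊆I down
  go : i ⋆ˢ Z ≈ y
  go a = trans (cong (_⟨$⟩ʳ a) (⋆ˢ-descent i Z (subst₂ _≤_
    (sym (ℓ-cong (s i · Z) (s i · y) (cong (s i ⟨$⟩ʳ_) ∘ ih))) (sym (ℓ-cong Z y ih)) (down i i∈I)))) (ih a)

-- The values exchanged by `s i` lie in one block of `I`, hence come from one block of `J`, where
-- `y` decreases. The inequality is read off from additivity in `y = s i · (s i · y)`.
decreasing⇒left-descents : (y : W m) → PermutesBlocks g I J y → DecreasingOn J y →
                           ∀ i → i ∈ I → ℓ (s i · y) ≤ ℓ y
decreasing⇒left-descents {g = g} {I = I} y perm dec i i∈I =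
  subst (ℓ (s i · y) ≤_)
    (trans (sym (keepsInversions⇒additive (s i) (s i · y) keeps))
           (ℓ-cong (s i · (s i · y)) y λ a → s-involutive i (y ⟨$⟩ʳ a)))
    (m≤n+m (ℓ (s i · y)) (ℓ (s i)))
  where
  keeps : KeepsInversions (s i) (s i · y)
  keeps a c a≺c inv = subst₂ _≺_ (sym (s-involutive i _)) (sym (s-involutive i _)) y-inv
    where
    y-inv : y ⟨$⟩ʳ c ≺ y ⟨$⟩ʳ a
    y-inv with Finₚ.<-cmp (y ⟨$⟩ʳ a) (y ⟨$⟩ʳ c)
    ... | tri> _ _ p = p
    ... | tri≈ _ e _ = contradiction a≺c (<-irrefl (cong toℕ (⟨$⟩ʳ-injective y e)))
    ... | tri< p _ _ with s-inverts i p inv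
    ...   | ya≡ , yc≡ = decreasing-block y dec a≺c (trans (sym (perm a))
            (trans (cong g (trans (cong (block I) ya≡) (trans (sym (block-∈ i∈I)) (cong (block I) (sym yc≡)))))
                   (perm c)))

module _ {m} {M : Subset m} (w : W m) {d t : Fin m} (d∈M : d ∈ M)
         (w-pres : PreservesBlocks M w) (w-dec : DecreasingOn M w)
         (w-left : w ⟨$⟩ʳ inject₁ d ≡ suc t) (w-right : w ⟨$⟩ʳ suc d ≡ inject₁ t) where

  private
    k : ℕ
    k = block M (inject₁ d)

    block-right : block M (suc d) ≡ k
    block-right = block-∈ d∈M

    block-t : block M (inject₁ t) ≡ k
    block-t = trans (cong (block M) (sym w-right)) (trans (w-pres (suc d)) block-right)

    block-suc-t : block M (suc t) ≡ k
    block-suc-t = trans (cong (block M) (sym w-left)) (w-pres (inject₁ d))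

    below : {c : Fin (suc m)} (e : Fin m) → c ≺ inject₁ e → toℕ c ≤ toℕ e
    below e p = <⇒≤ (subst (_ <_) (Finₚ.toℕ-inject₁ e) p)

  image-∈ : t ∈ M
  image-∈ with t ∈? M
  ... | yes p = p
  ... | no p = contradiction (trans (sym block-suc-t) (trans (block-∉ p) (cong suc block-t)))
                             (<⇒≢ (n<1+n k))

  -- Only block `k` of `M` is cut, after `d` in the source and after `t` in the target. As `w`
  -- reverses this block and sends one cut to the other, it interchanges the two halves; later
  -- blocks are renumbered alike on both sides.
  swaps-blocks : PermutesBlocks (τ k) (M - t) (M - d) w
  swaps-blocks a with <-cmp (block M a) k
  ... | tri< b<k _ _ =
    trans (cong (τ k) (trans (block-remove-≤ image-∈ wa≤t) (w-pres a)))
    (trans (τ-below k b<k) (sym (block-remove-≤ d∈M a≤d)))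
    where
    a≤d : toℕ a ≤ toℕ d
    a≤d = below d (block-cancel-< M b<k)
    wa≤t : toℕ (w ⟨$⟩ʳ a) ≤ toℕ t
    wa≤t = below t (block-cancel-< M (subst₂ _<_ (sym (w-pres a)) (sym block-t) b<k))
  ... | tri> _ _ b>k =
    trans (cong (τ k) (trans (block-remove-> image-∈ t<wa) (cong suc (w-pres a))))
    (trans (τ-above k (s≤s b>k)) (sym (block-remove-> d∈M d<a)))
    where
    d<a : toℕ d < toℕ a
    d<a = <⇒≤ (block-cancel-< M (subst (_< block M a) (sym block-right) b>k))
    t<wa : toℕ t < toℕ (w ⟨$⟩ʳ a)
    t<wa = <⇒≤ (block-cancel-< M (subst₂ _<_ (sym block-suc-t) (sym (w-pres a)) b>k))
  ... | tri≈ _ b≡k _ with Finₚ.<-cmp a (suc d)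
  ...   | tri≈ _ refl _ =
    trans (cong (τ k) (trans (block-remove-≤ image-∈ (≤-reflexive (trans (cong toℕ w-right) (Finₚ.toℕ-inject₁ t))))
                             (trans (w-pres (suc d)) b≡k)))
    (trans (τ-left k) (sym (trans (block-remove-> d∈M (n<1+n _)) (cong suc b≡k))))
  ...   | tri> _ _ d<a =
    trans (cong (τ k) (trans (block-remove-≤ image-∈ wa≤t) (trans (w-pres a) b≡k)))
    (trans (τ-left k) (sym (trans (block-remove-> d∈M (<⇒≤ d<a)) (cong suc b≡k))))
    where
    wa≤t : toℕ (w ⟨$⟩ʳ a) ≤ toℕ t
    wa≤t = below t (subst (w ⟨$⟩ʳ a ≺_) w-right
             (decreasing-block w w-dec d<a (trans block-right (sym b≡k))))
  ...   | tri< a<d _ _ =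
    trans (cong (τ k) (trans (block-remove-> image-∈ t<wa) (cong suc (trans (w-pres a) b≡k))))
    (trans (τ-right k) (sym (trans (block-remove-≤ d∈M (≤-pred a<d)) b≡k)))
    where
    t<wa : toℕ t < toℕ (w ⟨$⟩ʳ a)
    t<wa with ≺suc d a<d
    ... | inj₁ refl = ≤-reflexive (cong toℕ (sym w-left))
    ... | inj₂ p = <⇒≤ (subst (_≺ w ⟨$⟩ʳ a) w-left (decreasing-block w w-dec p b≡k))

-- The values of w at the two positions of d are neighbours since w reverses the
-- block containing them.
longest-neighbours : {M : Subset m} (w : W m) {d : Fin m} → d ∈ M → PreservesBlocks M w → DecreasingOn M w →
                     ∃[ t ] (w ⟨$⟩ʳ inject₁ d ≡ suc t × w ⟨$⟩ʳ suc d ≡ inject₁ t)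
longest-neighbours {M = M} w {d} d∈M pres dec with w ⟨$⟩ʳ inject₁ d in left≡ | dec d d∈M
... | suc t | desc with ≺suc t desc
...   | inj₁ right≡ = t , refl , right≡
...   | inj₂ between = contradiction (Finₚ.<-cmp c (suc d)) λ
  { (tri≈ _ e _) → <-irrefl (cong toℕ (trans (cong (w ⟨$⟩ʳ_) (sym e)) wc≡)) between
  ; (tri> _ _ d≺c) → <-asym between (subst (_≺ w ⟨$⟩ʳ suc d) wc≡
      (decreasing-block w dec d≺c (trans (block-∈ d∈M) (sym c-block))))
  ; (tri< c≺d _ _) → before (≺suc d c≺d) }
  where
  c = w ⟨$⟩ˡ inject₁ t
  wc≡ : w ⟨$⟩ʳ c ≡ inject₁ t
  wc≡ = inverseʳ w
  k = block M (inject₁ d)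
  c-block : block M c ≡ k
  c-block = trans (sym (pres c)) (≤-antisym
    (≤-trans (block-mono M (≤-trans (≤-reflexive (cong toℕ wc≡)) (<⇒≤ (inject₁≺suc t))))
             (≤-reflexive (trans (cong (block M) (sym left≡)) (pres (inject₁ d)))))
    (≤-trans (≤-reflexive (trans (sym (block-∈ d∈M)) (sym (pres (suc d)))))
             (≤-trans (block-mono M (<⇒≤ between)) (≤-reflexive (cong (block M) (sym wc≡))))))
  before : ¬ (c ≡ inject₁ d ⊎ c ≺ inject₁ d)
  before (inj₁ e) = <-irrefl (cong toℕ (trans (sym wc≡) (trans (cong (w ⟨$⟩ʳ_) e) left≡))) (inject₁≺suc t)
  before (inj₂ p) = <-asym (inject₁≺suc t)
    (subst₂ _≺_ left≡ wc≡ (decreasing-block w dec p c-block))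

abstract

  atomic-permutesBlocks : ∀ {i} (a : Coset L I) → IsAtomic i a →
    ∃[ d ] ∃[ k ] (i ≡ suc k × d ∉ I × block I (inject₁ d) ≡ k ×
                   k < length (gaps I) × length (gaps L) ≡ length (gaps I) ×
                   PermutesBlocks (τ k) L I (rep a))
  atomic-permutesBlocks {L = L} {I = I} a atomic =
    d , toℕ k , i-eq , d∉I , block-d , Finₚ.toℕ<n k , same-length ,
    permutesBlocks-rep a {g = τ (toℕ k)} w w∈a w-perm
    where
    open IsAtomic atomic
    d∉I : d ∉ I
    d∉I = proj₁ (Numbered-lookup (gaps-numbered I) k)
    block-d : block I (inject₁ d) ≡ toℕ k
    block-d = proj₂ (Numbered-lookup (gaps-numbered I) k)
    d∈M : d ∈ M
    d∈M = x∈p∪q⁺ (inj₂ (x∈⁅x⁆ d))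
    M-d : M - d ≡ I
    M-d = ∪-remove I d∉I
    block-M-d : block M (inject₁ d) ≡ toℕ k
    block-M-d = trans (sym (block-remove-≤ d∈M (≤-reflexive (Finₚ.toℕ-inject₁ d))))
                      (trans (cong (λ K → block K (inject₁ d)) M-d) block-d)
    w-pres : PreservesBlocks M w
    w-pres = ∈⟨⟩⇒preservesBlocks w (proj₁ w-longest)
    w-dec : DecreasingOn M w
    w-dec = isLongest⇒decreasing w w-longest
    swapped : ∀ b → s t ⟨$⟩ʳ (w ⟨$⟩ʳ b) ≡ w ⟨$⟩ʳ (s d ⟨$⟩ʳ b)
    swapped b = trans (t-eq (w ⟨$⟩ʳ b))
      (cong (λ c → w ⟨$⟩ʳ (s d ⟨$⟩ʳ c)) (longest-involutive w w-pres w-dec b))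
    -- `s t` exchanges the values of `w` at the two positions of `d`, reversing their order, and its
    -- own pair is the only one it reverses.
    values : w ⟨$⟩ʳ suc d ≡ inject₁ t × w ⟨$⟩ʳ inject₁ d ≡ suc t
    values = s-inverts t (w-dec d d∈M) (subst₂ _≺_
      (sym (trans (swapped (inject₁ d)) (cong (w ⟨$⟩ʳ_) (s-left d))))
      (sym (trans (swapped (suc d)) (cong (w ⟨$⟩ʳ_) (s-right d)))) (w-dec d d∈M))
    w-perm : PermutesBlocks (τ (toℕ k)) L I w
    w-perm = subst (λ K → PermutesBlocks (τ (toℕ k)) K I w) (sym left-eq)
      (subst₂ (λ b K → PermutesBlocks (τ b) (M - t) K w) block-M-d M-d
        (swaps-blocks w d∈M w-pres w-dec (proj₂ values) (proj₁ values)))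
    same-length : length (gaps L) ≡ length (gaps I)
    same-length = trans (cong (length ∘ gaps) left-eq) (trans
      (length-gaps-remove (image-∈ w d∈M w-pres w-dec (proj₂ values) (proj₁ values)))
      (trans (sym (length-gaps-remove d∈M)) (cong (length ∘ gaps) M-d)))

abstract

  longestElement : (J : Subset m) → ∃[ w ] (PreservesBlocks J w × DecreasingOn J w)
  longestElement J with climb {g = id} {I = J} {J = J} 1ᵂ (λ _ → refl)
  ... | w , pres , dec , _ = w , pres , dec

conjugates : {M : Subset m} (w : W m) {d t : Fin m} → PreservesBlocks M w → DecreasingOn M w →
             w ⟨$⟩ʳ inject₁ d ≡ suc t → w ⟨$⟩ʳ suc d ≡ inject₁ t → s t ≈ w · s d · w
conjugates w {d} {t} pres dec left≡ right≡ a =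
  trans (cong (s t ⟨$⟩ʳ_) (sym (longest-involutive w pres dec a))) (swapped (w ⟨$⟩ʳ a))
  where
  swapped : ∀ b → s t ⟨$⟩ʳ (w ⟨$⟩ʳ b) ≡ w ⟨$⟩ʳ (s d ⟨$⟩ʳ b)
  swapped b with place d b
  ... | left = trans (cong (s t ⟨$⟩ʳ_) left≡) (trans (s-right t)
                 (sym (trans (cong (w ⟨$⟩ʳ_) (s-left d)) right≡)))
  ... | right = trans (cong (s t ⟨$⟩ʳ_) right≡) (trans (s-left t)
                  (sym (trans (cong (w ⟨$⟩ʳ_) (s-right d)) left≡)))
  ... | off p q = trans (s-fix t
      (λ e → q (⟨$⟩ʳ-injective w (trans e (sym right≡))))
      (λ e → p (⟨$⟩ʳ-injective w (trans e (sym left≡)))))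
      (cong (w ⟨$⟩ʳ_) (sym (s-fix d p q)))

rep-∈ᶜ : (p : Coset I J) → rep p ∈ᶜ p
rep-∈ᶜ p = 1ᵂ , 1ᵂ , ([] , [] , λ _ → refl) , ([] , [] , λ _ → refl) , λ _ → refl

abstract

  atomic-exists : (I : Subset m) {k : ℕ} → k < length (gaps I) →
                  ∃[ L ] ∃ λ (a : Coset L I) → IsAtomic (suc k) a
  atomic-exists I {k} k< with longestElement (I ∪ ⁅ lookup (gaps I) (Fin.fromℕ< k<) ⁆)
  ... | w , pres , dec
    with longest-neighbours w (x∈p∪q⁺ (inj₂ (x∈⁅x⁆ (lookup (gaps I) (Fin.fromℕ< k<))))) pres dec
  ... | t , left≡ , right≡ =
    (I ∪ ⁅ lookup (gaps I) (Fin.fromℕ< k<) ⁆) - t , coset w , record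
      { k = Fin.fromℕ< k<
      ; i-eq = cong suc (sym (Finₚ.toℕ-fromℕ< k<))
      ; w = w
      ; w-longest = decreasing⇒isLongest w pres dec
      ; t = t
      ; t-eq = conjugates w pres dec left≡ right≡
      ; left-eq = refl
      ; w∈a = rep-∈ᶜ (coset w)
      }

-- Composition with an atomic coset on the left

module _ {m} {L I J : Subset m} {h : ℕ → ℕ} {k : ℕ} (x y w : W m)
         (x-perm : PermutesBlocks (τ k) L I x) (x-dec : DecreasingOn I x)
         (y-perm : PermutesBlocks h I J y) (y-dec : DecreasingOn J y)
         (w-pres : PreservesBlocks I w) (w-dec : DecreasingOn I w) where

  private
    -- The minimal representative of `x W_I`. A composition is reduced when the lengths of `x′` and
    -- `y` add.
    x′ : W m
    x′ = x · w ⁻¹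

    x′-perm : PermutesBlocks (τ k) L I x′
    x′-perm a = trans (x-perm (w ⟨$⟩ˡ a)) (preservesBlocks-⁻¹ w w-pres a)

    x′·w : x′ · w ≈ x
    x′·w a = cong (x ⟨$⟩ʳ_) (inverseˡ w)

    x′-increasing : ∀ {a c} → a ≺ c → block I a ≡ block I c → x′ ⟨$⟩ʳ a ≺ x′ ⟨$⟩ʳ c
    x′-increasing {a} {c} a≺c e with Finₚ.<-cmp (w ⟨$⟩ˡ a) (w ⟨$⟩ˡ c)
    ... | tri> _ _ p = decreasing-block x x-dec p (sym w⁻¹-same-block)
      where
      w⁻¹-same-block = trans (preservesBlocks-⁻¹ w w-pres a)
                             (trans e (sym (preservesBlocks-⁻¹ w w-pres c)))
    ... | tri≈ _ f _ = contradiction a≺c (<-irrefl (cong toℕ (⟨$⟩ʳ-injective (w ⁻¹) f)))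
    ... | tri< p _ _ = contradiction a≺c (<-asym
          (subst₂ _≺_ (inverseʳ w) (inverseʳ w) (decreasing-block w w-dec p w⁻¹-same-block)))
      where
      w⁻¹-same-block = trans (preservesBlocks-⁻¹ w w-pres a)
                             (trans e (sym (preservesBlocks-⁻¹ w w-pres c)))

  factor-length : ℓ x ≡ ℓ x′ + ℓ w
  factor-length = trans (ℓ-cong x (x′ · w) (sym ∘ x′·w))
    (keepsInversions⇒additive x′ w keeps)
    where
    keeps : KeepsInversions x′ w
    keeps a c a≺c inv with block I a ≟ block I c
    ... | yes e = x′-increasing inv (trans (w-pres c) (trans (sym e) (sym (w-pres a))))
    ... | no ≢ = contradiction (block-mono I (<⇒≤ inv)) (<⇒≱ (subst₂ _<_ (sym (w-pres a)) (sym (w-pres c))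
            (≤∧≢⇒< (block-mono I (<⇒≤ a≺c)) ≢)))

  factor-length-∸ : ℓ x′ ≡ ℓ x ∸ ℓ w
  factor-length-∸ = sym (trans (cong (_∸ ℓ w) factor-length) (m+n∸n≡m (ℓ x′) (ℓ w)))

  composite-permutesBlocks : PermutesBlocks (h ∘ τ k) L J (x′ · y)
  composite-permutesBlocks a = trans (cong h (x′-perm (y ⟨$⟩ʳ a))) (y-perm a)

  private
    x′-block : ∀ e → block L (x′ ⟨$⟩ʳ e) ≡ τ k (block I e)
    x′-block e = trans (sym (τ-involutive k _)) (cong (τ k) (x′-perm e))

    y⁻¹-block : ∀ e → block J (y ⟨$⟩ˡ e) ≡ h (block I e)
    y⁻¹-block e = trans (sym (y-perm (y ⟨$⟩ˡ e))) (cong (h ∘ block I) (inverseʳ y))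

  -- If `h` decreased at `k`, the last value of block `k` and the first of block `k + 1` would form
  -- an inversion of `y`, which `x′` undoes by swapping these blocks.
  additive⇒ascent : (∀ {a b} → h a ≡ h b → a ≡ b) → {d : Fin m} → d ∉ I →
                    block I (inject₁ d) ≡ k → ℓ (x′ · y) ≡ ℓ x′ + ℓ y → h k < h (suc k)
  additive⇒ascent inj {d} d∉I refl add with <-cmp (h k) (h (suc k))
  ... | tri< p _ _ = p
  ... | tri≈ _ e _ = contradiction (inj e) (<⇒≢ (n<1+n k))
  ... | tri> _ _ p = contradiction (n<1+n k) (≤⇒≯
        (subst₂ _≤_ (trans (x′-block (inject₁ d)) (τ-left k))
                    (trans (x′-block (suc d)) (trans (cong (τ k) (block-∉ d∉I)) (τ-right k)))
                    (block-mono L (<⇒≤ inverted))))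
    where
    c≺a : y ⟨$⟩ˡ suc d ≺ y ⟨$⟩ˡ inject₁ d
    c≺a = block-cancel-< J (subst₂ _<_
      (sym (trans (y⁻¹-block (suc d)) (cong h (block-∉ d∉I)))) (sym (y⁻¹-block (inject₁ d))) p)
    inverted : x′ ⟨$⟩ʳ inject₁ d ≺ x′ ⟨$⟩ʳ suc d
    inverted = subst₂ (λ e f → x′ ⟨$⟩ʳ e ≺ x′ ⟨$⟩ʳ f) (inverseʳ y) (inverseʳ y)
      (additive⇒keepsInversions x′ y add _ _ c≺a
        (subst₂ _≺_ (sym (inverseʳ y)) (sym (inverseʳ y)) (inject₁≺suc d)))

  -- `x′` keeps the order inside each block of `I`, and between blocks except for the pair `k`,
  -- `k + 1`; the ascent of `h` excludes an inversion of `y` between those two.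
  ascent⇒additive : h k < h (suc k) → ℓ (x′ · y) ≡ ℓ x′ + ℓ y
  ascent⇒additive hk< = keepsInversions⇒additive x′ y keeps
    where
    keeps : KeepsInversions x′ y
    keeps a c a≺c inv with block I (y ⟨$⟩ʳ c) ≟ block I (y ⟨$⟩ʳ a)
    ... | yes e = x′-increasing inv e
    ... | no ≢ = block-cancel-< L (subst₂ _<_ (sym (x′-block _)) (sym (x′-block _))
          (τ-mono k (≤∧≢⇒< (block-mono I (<⇒≤ inv)) ≢) λ (c≡ , a≡) →
            <⇒≱ hk< (subst₂ _≤_ (trans (sym (y-perm a)) (cong h a≡)) (trans (sym (y-perm c)) (cong h c≡))
              (block-mono J (<⇒≤ a≺c)))))

  -- Take a reduced word of `x` formed from one of `x′` followed by one of `w`: the letters of `w`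
  -- are left descents of `y` and get absorbed, those of `x′` multiply.
  additive⇒product : ℓ (x′ · y) ≡ ℓ x′ + ℓ y → x ⋆ y ≔ x′ · y
  additive⇒product add with ℓ-word x′ | preservesBlocks⇒reducedWord w w-pres
  ... | u , lu , eu | v , v⊆I , ev , lv =
    u ++ v ,
    ((λ a → trans (⟦⟧-++ u v a) (trans (cong (⟦ u ⟧ ⟨$⟩ʳ_) (ev a)) (trans (eu _) (x′·w a)))) ,
     trans (length-++ u) (trans (cong₂ _+_ lu lv) (sym factor-length))) ,
    λ a → trans (cong (_⟨$⟩ʳ a) (foldr-++ _⋆ˢ_ y u v))
          (trans (foldr-⋆ˢ-additive u y′ add′ a) (trans (cong (⟦ u ⟧ ⟨$⟩ʳ_) (y′≈y a)) (eu _)))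
    where
    y′ : W m
    y′ = foldr _⋆ˢ_ y v
    y′≈y : y′ ≈ y
    y′≈y = foldr-⋆ˢ-absorbed v y v⊆I (decreasing⇒left-descents {g = h} y y-perm y-dec)
    add′ : ℓ (⟦ u ⟧ · y′) ≡ length u + ℓ y′
    add′ = trans (ℓ-cong (⟦ u ⟧ · y′) (x′ · y) λ a → trans (cong (⟦ u ⟧ ⟨$⟩ʳ_) (y′≈y a)) (eu _))
      (trans add (cong₂ _+_ (sym lu) (ℓ-cong y y′ (sym ∘ y′≈y))))

module _ {m} {L I J : Subset m} {h : ℕ → ℕ} {k : ℕ}
         {a : Coset L I} {q : Coset I J} {r : Coset L J} (comp : a ⊙ q ≔ r)
         (a-perm : PermutesBlocks (τ k) L I (rep a))
         (q-perm : PermutesBlocks h I J (rep q)) where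

  private
    open _⊙_≔_ comp

    x-perm : PermutesBlocks (τ k) L I x
    x-perm = ∈ᶜ⇒permutesBlocks a {g = τ k} a-perm x (proj₁ x-max)

    x-dec : DecreasingOn I x
    x-dec = isMax⇒decreasing {g = τ k} a a-perm x x-max

    y-perm : PermutesBlocks h I J y
    y-perm = ∈ᶜ⇒permutesBlocks q {g = h} q-perm y (proj₁ y-max)

    y-dec : DecreasingOn J y
    y-dec = isMax⇒decreasing {g = h} q q-perm y y-max

    w-pres : PreservesBlocks I w
    w-pres = ∈⟨⟩⇒preservesBlocks w (proj₁ w-longest)

    w-dec : DecreasingOn I w
    w-dec = isLongest⇒decreasing w w-longest

  ⊙-permutesBlocks : PermutesBlocks (h ∘ τ k) L J (rep r)
  ⊙-permutesBlocks = permutesBlocks-rep r {g = h ∘ τ k} z z∈r λ b →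
    trans (cong (h ∘ τ k ∘ block L) (z-eq b))
          (composite-permutesBlocks {h = h} x y w x-perm x-dec y-perm y-dec w-pres w-dec b)

  ⊙-ascent : (∀ {a b} → h a ≡ h b → a ≡ b) → {d : Fin m} → d ∉ I →
             block I (inject₁ d) ≡ k → h k < h (suc k)
  ⊙-ascent inj d∉I block-d =
    additive⇒ascent {h = h} x y w x-perm x-dec y-perm y-dec w-pres w-dec inj d∉I block-d
      (trans (ℓ-cong (x · w ⁻¹ · y) z (sym ∘ z-eq)) (trans length-eq
        (cong (_+ ℓ y) (sym (factor-length-∸ {h = h} x y w x-perm x-dec y-perm y-dec w-pres w-dec)))))

-- Expressions of a coset and reduced words of its block permutation

expression⇒reduced : {p : Coset I J} → IsReducedExpression us p →
  ∃[ g ] (Reduced (length (gaps J)) g us × PermutesBlocks g I J (rep p) ×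
          length (gaps I) ≡ length (gaps J))
expression⇒reduced {p = p} ([] refl 1∈p) =
  id , nil (λ _ → refl) , permutesBlocks-rep p {g = id} 1ᵂ 1∈p (λ _ → refl) , refl
expression⇒reduced {J = J} (_∷_ {a = a} (atomic , comp) expr)
  with expression⇒reduced expr | atomic-permutesBlocks a atomic
... | h , red , q-perm , q-len | d , k , refl , d∉I , block-d , k< , a-len , a-perm =
  h ∘ τ k ,
  -- The descent of `h ∘ τ k` at `k` is the ascent of `h` at `k` given by the composition.
  cons (subst (k <_) q-len k<)
    (subst₂ _<_ (cong h (sym (τ-right k))) (cong h (sym (τ-left k)))
      (⊙-ascent {h = h} comp a-perm q-perm (Reduced-injective red) d∉I block-d))
    (Reduced-resp (λ n → cong h (sym (τ-involutive k n))) red) ,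
  ⊙-permutesBlocks {h = h} comp a-perm q-perm ,
  trans a-len q-len

-- Only `J` is given, and the construction grows to the left, so the left-hand subset and the coset
-- are outputs; they are matched with a prescribed coset afterwards.
reduced⇒expression : (J : Subset m) → Reduced (length (gaps J)) g us →
  ∃[ I ] ∃ λ (p : Coset I J) → IsReducedExpression us p × PermutesBlocks g I J (rep p) ×
    length (gaps I) ≡ length (gaps J)
reduced⇒expression {g = g} J (nil g≗id) =
  J , coset 1ᵂ , [] refl (rep-∈ᶜ (coset 1ᵂ)) ,
  (λ a → g≗id (block J a)) , refl
reduced⇒expression {m = m} {g = g} J (cons {k} {us} k<l desc red)
  with reduced⇒expression J red
... | I , q , expr , q-perm , q-len
  with atomic-exists I (subst (k <_) (sym q-len) k<l)
... | L , a , atomic with atomic-permutesBlocks a atomic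
... | _ , _ , refl , _ , _ , _ , a-len , a-perm
  with climb {g = τ k} (rep a) a-perm | climb {g = g ∘ τ k} (rep q) q-perm | longestElement I
... | x , x-perm , x-dec , _ | y , y-perm , y-dec , _ | w , w-pres , w-dec =
  L , coset z , (atomic , comp) ∷ expr , z-perm , trans a-len q-len
  where
  h : ℕ → ℕ
  h = g ∘ τ k
  z : W m
  z = x · w ⁻¹ · y
  add : ℓ z ≡ ℓ (x · w ⁻¹) + ℓ y
  add = ascent⇒additive {h = h} x y w x-perm x-dec y-perm y-dec w-pres w-dec
    (subst₂ _<_ (cong g (sym (τ-left k))) (cong g (sym (τ-right k))) desc)
  z-perm : PermutesBlocks g L J z
  z-perm b = trans (cong g (sym (τ-involutive k _)))
    (composite-permutesBlocks {h = h} x y w x-perm x-dec y-perm y-dec w-pres w-dec b)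
  comp : a ⊙ q ≔ coset z
  comp = record
    { x = x ; y = y ; z = z ; w = w
    ; x-max = decreasing⇒isMax {g = τ k} a
        (λ e → trans (sym (τ-involutive k _)) (trans (cong (τ k) e) (τ-involutive k _)))
        a-perm x x-perm x-dec
    ; y-max = decreasing⇒isMax {g = h} q (Reduced-injective red) q-perm y y-perm y-dec
    ; product = additive⇒product {h = h} x y w x-perm x-dec y-perm y-dec w-pres w-dec add
    ; z∈r = rep-∈ᶜ (coset z)
    ; w-longest = decreasing⇒isLongest w w-pres w-dec
    ; z-eq = λ _ → refl
    ; length-eq = trans add (cong (_+ ℓ y)
        (factor-length-∸ {h = h} x y w x-perm x-dec y-perm y-dec w-pres w-dec))
    }

expression-resp : {p q : Coset I J} → (∀ x → x ∈ᶜ p → x ∈ᶜ q) →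
                  IsReducedExpression us p → IsReducedExpression us q
expression-resp p⊆q ([] e 1∈p) = [] e (p⊆q 1ᵂ 1∈p)
expression-resp p⊆q ((atomic , comp) ∷ expr) = (atomic , comp′) ∷ expr
  where
  open _⊙_≔_ comp
  comp′ = record
    { x = x ; y = y ; z = z ; w = w ; x-max = x-max ; y-max = y-max ; product = product
    ; z∈r = p⊆q z z∈r ; w-longest = w-longest ; z-eq = z-eq ; length-eq = length-eq }

reduced⇒expression-of : (p : Coset I J) → PermutesBlocks g I J (rep p) →
                        Reduced (length (gaps J)) g us → IsReducedExpression us p
reduced⇒expression-of {I = I} {J = J} {g = g} p p-perm red with reduced⇒expression J red
... | I′ , q , expr , q-perm , _
  with climb {g = g} (rep p) p-perm | climb {g = g} (rep q) q-perm
... | x , x-perm , x-dec , _ | y , y-perm , y-dec , _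
  with blocks-unique {g = g} (Reduced-injective red) x y x-perm y-perm x-dec y-dec
... | refl = expression-resp
  (λ z z∈q → permutesBlocks⇒∈ᶜ p {g = g} p-perm z (∈ᶜ⇒permutesBlocks q {g = g} q-perm z z∈q)) expr

-- `x` sees `g` and `h` on the actual block numbers `0` to `l`; above `l` reducedness makes both the
-- identity.
permutesBlocks-determines : {g h : ℕ → ℕ} {l : ℕ} (x : W m) → l ≡ length (gaps I) →
  Reduced l g us → Reduced l h vs →
  PermutesBlocks g I J x → PermutesBlocks h I J x → g ≗ h
permutesBlocks-determines {I = I} {g = g} {h = h} x refl red red′ perm perm′ n
  with n ≤? length (gaps I)
... | no n≰ = trans (Reduced-fixes-above red (≰⇒> n≰)) (sym (Reduced-fixes-above red′ (≰⇒> n≰)))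
... | yes n≤ with block-surjective I n≤
...   | b , refl = trans (cong (g ∘ block I) (sym (inverseʳ x)))
        (trans (trans (perm (x ⟨$⟩ˡ b)) (sym (perm′ (x ⟨$⟩ˡ b)))) (cong (h ∘ block I) (inverseʳ x)))

theorem3p14 : ∀ (m : ℕ) {I J : Subset m} (p : Coset I J) → IsCore p →
    ∀ (us vs : List ℕ) → IsReducedExpression us p → IsReducedExpression vs p →
    BraidEquivalent p us vs
theorem3p14 m {I} {J} p _ us vs us-expr vs-expr
  with expression⇒reduced us-expr | expression⇒reduced vs-expr
... | g , us-red , g-perm , len | h , vs-red , h-perm , _ =
  -- The chain of words stays as it is; each word in it is reduced for `g` and hence an expression
  -- of `p` itself.
  EqC.map (λ (r , r′ , b) → reduced⇒expression-of p g-perm r , reduced⇒expression-of p g-perm r′ , b)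
    (matsumoto us-red (Reduced-resp h≗g vs-red))
  where
  h≗g : h ≗ g
  h≗g = permutesBlocks-determines (rep p) (sym len) vs-red us-red h-perm g-perm
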